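{- Let $p$ be a prime and let $k$ be a positive integer. Then there exists a constant $r_0(p,k)$ such that for all $r\ge r_0(p,k)$ the following holds: for any positive integer $h$, put $q=p^h$, and let $\mathcal P$ be a finite classical polar space of rank $r$ over $\mathbb F_q$. Then $\mathcal P$ does not possess a family $\mathcal O$ of $k$-spaces such that each generator of $\mathcal P$ contains precisely one element of $\mathcal O$.
   Context: A finite classical polar space of rank $r$ over $\mathbb F_q$ consists of the subspaces of $V(n,q)=\mathbb F_q^n$ that are totally isotropic (totally singular in the quadratic case) with respect to a non-degenerate quadratic, symplectic or Hermitian form; up to isomorphism it is one of $Q^+(2r-1,q)$, $H(2r-1,q)$, $W(2r-1,q)$, $Q(2r,q)$, $H(2r,q)$, $Q^-(2r+1,q)$ (Hermitian ones only for $q$ a square). All dimensions are vector-space (algebraic) dimensions: a $k$-space of $\mathcal P$ is a totally isotropic subspace of dimension $k$, and the generators are the maximal totally isotropic subspaces, which have dimension $r$. -}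

module Defs where

open import Data.Nat using (ℕ; zero; suc)
open import Data.Fin using (Fin; zero; suc)
open import Data.Product using (Σ; ∃; _×_; _,_)
open import Data.List using (List)
open import Data.List.Membership.Propositional using (_∈_)
open import Relation.Binary.PropositionalEquality using (_≡_; _≢_)
open import Relation.Nullary using (¬_)
open import Algebra.Structures using (IsCommutativeRing)
open import Function.Bundles using (_↔_)

-- A finite field with q elements.  Equality is propositional; every finite
-- field is isomorphic to one of this shape (e.g. carried by Fin q).
record FiniteField (q : ℕ) : Set₁ where
  infixl 6 _+_
  infixl 7 _*_
  field
    Carrier : Set
    _+_ _*_ : Carrier → Carrier → Carrier
    -_ : Carrier → Carrier
    0# 1# : Carrier
    isCommutativeRing : IsCommutativeRing _≡_ _+_ _*_ -_ 0# 1#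
    0≢1 : 0# ≢ 1#
    inverse : ∀ x → x ≢ 0# → ∃ λ y → x * y ≡ 1#
    enumeration : Fin q ↔ Carrier

module _ {q : ℕ} (F : FiniteField q) where
  open FiniteField F

  Vect : ℕ → Set
  Vect n = Fin n → Carrier

  ∑ : ∀ {m} → (Fin m → Carrier) → Carrier
  ∑ {zero} f = 0#
  ∑ {suc m} f = f zero + ∑ (λ i → f (suc i))

  zeroV : ∀ {n} → Vect n
  zeroV _ = 0#

  _≋_ : ∀ {n} → Vect n → Vect n → Set
  v ≋ w = ∀ j → v j ≡ w j

  _⊕_ : ∀ {n} → Vect n → Vect n → Vect n
  (v ⊕ w) j = v j + w j

  comb : ∀ {m n} → (Fin m → Vect n) → (Fin m → Carrier) → Vect n
  comb B c j = ∑ (λ i → c i * B i j)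

  LinIndep : ∀ {m n} → (Fin m → Vect n) → Set
  LinIndep B = ∀ c → comb B c ≋ zeroV → ∀ i → c i ≡ 0#

  _∈Span_ : ∀ {m n} → Vect n → (Fin m → Vect n) → Set
  v ∈Span B = ∃ λ c → v ≋ comb B c

  _⊆_ : ∀ {m m' n} → (Fin m → Vect n) → (Fin m' → Vect n) → Set
  B ⊆ C = ∀ i → B i ∈Span C

  _≐_ : ∀ {m m' n} → (Fin m → Vect n) → (Fin m' → Vect n) → Set
  B ≐ C = (B ⊆ C) × (C ⊆ B)

  record Involution : Set where
    field
      σ : Carrier → Carrier
      σ-+ : ∀ x y → σ (x + y) ≡ σ x + σ y
      σ-* : ∀ x y → σ (x * y) ≡ σ x * σ y
      σ-1 : σ 1# ≡ 1#
      σ-σ : ∀ x → σ (σ x) ≡ x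
      σ-nontrivial : ∃ λ x → σ x ≢ x

  data Form (n : ℕ) : Set where
    -- Q(x) = Σ_{i,j} a_ij x_i x_j
    quadratic  : (a : Fin n → Fin n → Carrier) → Form n
    -- f(x,y) = Σ_{i,j} x_i M_ij y_j
    symplectic : (M : Fin n → Fin n → Carrier) → Form n
    -- f(x,y) = Σ_{i,j} x_i M_ij σ(y_j)
    hermitian  : (θ : Involution) → (M : Fin n → Fin n → Carrier) → Form n

  quadVal : ∀ {n} → (Fin n → Fin n → Carrier) → Vect n → Carrier
  quadVal a x = ∑ (λ i → ∑ (λ j → a i j * x i * x j))

  quadPolar : ∀ {n} → (Fin n → Fin n → Carrier) → Vect n → Vect n → Carrier
  quadPolar a x y = quadVal a (x ⊕ y) + - quadVal a x + - quadVal a y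

  sesq : ∀ {n} → (Carrier → Carrier) → (Fin n → Fin n → Carrier) → Vect n → Vect n → Carrier
  sesq σ M x y = ∑ (λ i → ∑ (λ j → x i * M i j * σ (y j)))

  IsPolarForm : ∀ {n} → Form n → Set
  IsPolarForm {n} (quadratic a) =
    ∀ (x : Vect n) → quadVal a x ≡ 0# → (∀ y → quadPolar a x y ≡ 0#) → x ≋ zeroV
  IsPolarForm {n} (symplectic M) =
    (∀ i → M i i ≡ 0#) × (∀ i j → M j i ≡ - M i j) ×
    (∀ (x : Vect n) → (∀ y → sesq (λ z → z) M x y ≡ 0#) → x ≋ zeroV)
  IsPolarForm {n} (hermitian θ M) =
    (∀ i j → M j i ≡ Involution.σ θ (M i j)) ×
    (∀ (x : Vect n) → (∀ y → sesq (Involution.σ θ) M x y ≡ 0#) → x ≋ zeroV)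

  TotIso : ∀ {m n} → Form n → (Fin m → Vect n) → Set
  TotIso (quadratic a) B = ∀ c → quadVal a (comb B c) ≡ 0#
  TotIso (symplectic M) B = ∀ c d → sesq (λ z → z) M (comb B c) (comb B d) ≡ 0#
  TotIso (hermitian θ M) B = ∀ c d → sesq (Involution.σ θ) M (comb B c) (comb B d) ≡ 0#

  IsSpace : ∀ {n} → Form n → (m : ℕ) → (Fin m → Vect n) → Set
  IsSpace P m B = LinIndep B × TotIso P B

  HasRank : ∀ {n} → Form n → ℕ → Set
  HasRank {n} P r =
    (Σ (Fin r → Vect n) λ B → IsSpace P r B) ×
    (∀ (B : Fin (suc r) → Vect n) → ¬ IsSpace P (suc r) B)

  IsGenerator : ∀ {n} → Form n → (m : ℕ) → (Fin m → Vect n) → Set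
  IsGenerator {n} P m G =
    IsSpace P m G ×
    (∀ (C : Fin (suc m) → Vect n) → IsSpace P (suc m) C → ¬ (G ⊆ C))

  EveryGeneratorContainsExactlyOne :
    ∀ {n k} → Form n → List (Fin k → Vect n) → Set
  EveryGeneratorContainsExactlyOne {n} {k} P O =
    ∀ (m : ℕ) (G : Fin m → Vect n) → IsGenerator P m G →
      Σ (Fin k → Vect n) λ B → (B ∈ O) × (B ⊆ G) ×
        (∀ B' → B' ∈ O → B' ⊆ G → B' ≐ B)

{-# OPTIONS --safe #-}
module Submission where

-- Two members of O that are orthogonal lie in a common generator, so they are equal. Extend a maximal totally isotropic
-- e_1, …, e_r to a hyperbolic system e, f and consider the generators spanned by the e_i + Σ_j T_ij f_j, for skew matrices T.
-- A nonzero vector lies in at most a fraction q^(1-r) of them, so the members of O in these generators number at least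
-- q^(r-1). On the other hand (Blokhuis and Moorhouse) the matrix Π_(a,b) (1 - β(A_a, B_b)^(q-1)), indexed by such members
-- A and B, is the identity matrix. As β has rank at most 2r on the span of e and f, and y^(q-1) is the product of the
-- p^t-th powers of y^(p-1) for t < h, each of rank at most (2r)^(p-1) because the Frobenius map is additive, the rank of
-- this matrix is at most (1 + (2r)^((p-1)h))^(k²). Since 1 + x^h ≤ (1 + x)^h, both bounds may be compared as h-th powers,
-- so h drops out, and the exponential p^(r-1) beats the polynomial in r.

open import Defs
open import Algebra.Bundles using (CommutativeRing; CommutativeMonoid)
open import Data.Fin as Fin using (Fin; zero; suc; toℕ; fromℕ; splitAt; punchIn; finToFun; funToFin)
open import Data.Fin.Permutation using (permutation)
import Data.Fin.Properties as Fin
open import Data.List using (List)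
open import Data.List.Membership.Propositional using (_∈_)
open import Data.List.Relation.Unary.All as All using (All)
open import Data.Nat as ℕ using (ℕ; zero; suc)
open import Data.Nat.Combinatorics using (nCn≡1)
open import Data.Nat.Divisibility using (_∣_; divides)
open import Data.Nat.Primality using (Prime; ¬prime[0]; ¬prime[1])
import Data.Nat.Properties as ℕ
open import Data.Product using (Σ; ∃; _×_; _,_; proj₁; proj₂)
open import Data.Sum using (_⊎_; inj₁; inj₂; [_,_]′)
open import Data.Vec.Functional using (_∷_)
open import Function using (_∘_; id; flip)
open import Function.Bundles using (Inverse)
open import Function.Definitions using (Injective)
open import Level using (0ℓ)
open import Relation.Binary.Definitions using (DecidableEquality; Decidable; tri<; tri≈; tri>)
open import Relation.Binary.PropositionalEquality
open import Relation.Nullary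
open import Relation.Nullary.Decidable using (map′; decidable-stable)

-- The rank estimate must not involve the ambient dimension `n`, and bounding `n` in terms of `r`
-- would require the theory of anisotropic forms over finite fields. Working only with generators
-- inside the span of `e` and `f` replaces `n` by 2r. It also gives a family of generators with an
-- explicit parametrisation, the same for all kinds of forms, so that the generators of the polar
-- space never have to be counted. The parameters are arbitrary matrices, which `T` makes skew:
-- repetitions do no harm because only proportions are compared. The fraction q^(1-r) arises
-- because, for a vector with a nonzero coefficient at e_i, lying on the graph determines row i of
-- the parameter matrix from the other rows, except for its diagonal entry. Members of `O` are given
-- by bases, and membership in a span is not decided. Equality of members is therefore replaced by
-- orthogonality, which is a finite system of equations over the field. Common generators exist up
-- to double negation only. This is enough, since the facts extracted from them are equations in a
-- field with decidable equality.

module Arithmetic where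
  open import Data.Nat
  open import Data.Nat.Combinatorics using (_C_; nCk+nC[k+1]≡[n+1]C[k+1]; nC1≡n; k>n⇒nCk≡0)
  open import Data.Nat.Divisibility using (divides-refl; ∣⇒≤)
  open import Data.Nat.DivMod
  open import Data.Nat.Primality using (euclidsLemma)
  open import Data.Nat.Properties
  open import Data.Nat.Solver

  -- Divisibility of binomial coefficients by a prime.

  absorption : ∀ n k → suc k * (suc n C suc k) ≡ suc n * (n C k)
  absorption n zero = trans (*-identityˡ _) (trans (nC1≡n (suc n)) (sym (*-identityʳ (suc n))))
  absorption zero (suc k) rewrite k>n⇒nCk≡0 {1} {suc (suc k)} (s≤s (s≤s z≤n)) | k>n⇒nCk≡0 {0} {suc k} (s≤s z≤n) = *-zeroʳ (suc (suc k))
  absorption (suc n) (suc k) = begin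
    (2 + k) * (suc (suc n) C (2 + k))                              ≡⟨ cong ((2 + k) *_) (sym (nCk+nC[k+1]≡[n+1]C[k+1] (suc n) (suc k))) ⟩
    (2 + k) * (suc n C suc k + suc n C (2 + k))                    ≡⟨ solve 3 (λ k x y → (con 2 :+ k) :* (x :+ y) := x :+ ((con 1 :+ k) :* x :+ (con 2 :+ k) :* y)) refl k (suc n C suc k) (suc n C (2 + k)) ⟩
    suc n C suc k + (suc k * (suc n C suc k) + (2 + k) * (suc n C (2 + k))) ≡⟨ cong (suc n C suc k +_) (cong₂ _+_ (absorption n k) (absorption n (suc k))) ⟩
    suc n C suc k + (suc n * (n C k) + suc n * (n C suc k))        ≡⟨ cong (suc n C suc k +_) (sym (*-distribˡ-+ (suc n) (n C k) (n C suc k))) ⟩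
    suc n C suc k + suc n * (n C k + n C suc k)                    ≡⟨ cong (λ z → suc n C suc k + suc n * z) (nCk+nC[k+1]≡[n+1]C[k+1] n k) ⟩
    suc (suc n) * (suc n C suc k)                                  ∎
    where
    open ≡-Reasoning
    open +-*-Solver

  -- By `absorption`, p divides k times the binomial coefficient, and it cannot divide the smaller
  -- positive factor k.
  prime∣C : ∀ {p} → Prime p → ∀ k → 0 < k → k < p → p ∣ p C k
  prime∣C {suc n} pr (suc k) _ k<p
    with euclidsLemma (suc k) (suc n C suc k) pr (divides-refl (n C k) ∣-respʳ (trans (absorption n k) (*-comm (suc n) _)))
    where
    _∣-respʳ_ : ∀ {a b c} → a ∣ b → c ≡ b → a ∣ c
    d ∣-respʳ refl = d
  ... | inj₁ p∣k = contradiction (∣⇒≤ p∣k) (<⇒≱ k<p)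
  ... | inj₂ p∣C = p∣C

  -- Exponential against polynomial growth.

  n<2^n : ∀ n → n < 2 ^ n
  n<2^n zero = s≤s z≤n
  n<2^n (suc n) = begin-strict
    suc n         <⟨ +-mono-≤-< (m^n>0 2 n) (n<2^n n) ⟩
    2 ^ n + 2 ^ n ≡⟨ cong (2 ^ n +_) (sym (+-identityʳ _)) ⟩
    2 ^ suc n     ∎
    where open ≤-Reasoning

  -- Let m be the quotient of r by 2d, and c = 3 + 4d. Then 3 + 2r is at most c(m + 1), which is
  -- below 2^(c + m). Once r is at least 2dc, also c ≤ m, so the d-th power stays below 2^(2dm) ≤
  -- 2^r. The linear function is 1 + 2(r + 1), as the lemma is applied to the predecessor of the
  -- rank.
  linear^d<2^ : ∀ d .{{_ : NonZero d}} → ∃ λ r₀ → ∀ r → r₀ ≤ r → (3 + (r + r)) ^ d < 2 ^ r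
  linear^d<2^ d = (d + d) * c , λ r r₀≤r →
    let m = r / (d + d)
        c≤m : c ≤ m
        c≤m = subst (_≤ m) (trans (cong (_/ (d + d)) (*-comm (d + d) c)) (m*n/n≡m c (d + d))) (/-monoˡ-≤ (d + d) r₀≤r)
        r≤ : r ≤ (d + d) * suc m
        r≤ = begin
          r                             ≡⟨ m≡m%n+[m/n]*n r (d + d) ⟩
          r % (d + d) + m * (d + d)     ≤⟨ +-monoˡ-≤ _ (<⇒≤ (m%n<n r (d + d))) ⟩
          suc m * (d + d)               ≡⟨ *-comm (suc m) (d + d) ⟩
          (d + d) * suc m               ∎
        base : 3 + (r + r) < 2 ^ (c + m)
        base = begin-strict
          3 + (r + r)                   ≤⟨ +-monoʳ-≤ 3 (+-mono-≤ r≤ r≤) ⟩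
          3 + ((d + d) * suc m + (d + d) * suc m) ≤⟨ m≤m+n _ (3 * m) ⟩
          3 + ((d + d) * suc m + (d + d) * suc m) + 3 * m
            ≡⟨ solve 2 (λ d m → con 3 :+ ((d :+ d) :* (con 1 :+ m) :+ (d :+ d) :* (con 1 :+ m)) :+ con 3 :* m
                             := (con 3 :+ (d :+ d :+ (d :+ d))) :* (con 1 :+ m)) refl d m ⟩
          c * suc m                     ≤⟨ *-monoʳ-≤ c (n<2^n m) ⟩
          c * 2 ^ m                     <⟨ *-monoˡ-< (2 ^ m) {{m^n≢0 2 m}} (n<2^n c) ⟩
          2 ^ c * 2 ^ m                 ≡⟨ sym (^-distribˡ-+-* 2 c m) ⟩
          2 ^ (c + m)                   ∎
    in begin-strict
      (3 + (r + r)) ^ d                 <⟨ ^-monoˡ-< d base ⟩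
      (2 ^ (c + m)) ^ d                 ≡⟨ ^-*-assoc 2 (c + m) d ⟩
      2 ^ ((c + m) * d)                 ≤⟨ ^-monoʳ-≤ 2 (*-monoˡ-≤ d (+-monoˡ-≤ m c≤m)) ⟩
      2 ^ ((m + m) * d)                 ≡⟨ cong (2 ^_) (solve 2 (λ m d → (m :+ m) :* d := m :* (d :+ d)) refl m d) ⟩
      2 ^ (m * (d + d))                 ≤⟨ ^-monoʳ-≤ 2 (m/n*n≤m r (d + d)) ⟩
      2 ^ r                             ∎
    where
    open ≤-Reasoning
    open +-*-Solver
    c = 3 + (d + d + (d + d))
    instance
      d+d≢0 : NonZero (d + d)
      d+d≢0 = >-nonZero (<-≤-trans (>-nonZero⁻¹ d) (m≤m+n d d))

  1+x^n≤[1+x]^n : ∀ x n .{{_ : NonZero n}} → suc (x ^ n) ≤ suc x ^ n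
  1+x^n≤[1+x]^n x (suc zero) = ≤-refl
  1+x^n≤[1+x]^n x (suc (suc n)) = begin
    suc (x * x ^ suc n)          ≤⟨ s≤s (*-monoʳ-≤ x (^-monoˡ-≤ (suc n) (n≤1+n x))) ⟩
    suc (x * suc x ^ suc n)      ≤⟨ +-monoˡ-≤ _ (m^n>0 (suc x) (suc n)) ⟩
    suc x ^ suc (suc n)          ∎
    where open ≤-Reasoning

  ^-distribʳ-* : ∀ n x y → (x * y) ^ n ≡ x ^ n * y ^ n
  ^-distribʳ-* zero    x y = refl
  ^-distribʳ-* (suc n) x y = trans (cong (x * y *_) (^-distribʳ-* n x y)) (medial x y (x ^ n) (y ^ n))
    where open import Algebra.Properties.CommutativeSemigroup *-commutativeSemigroup renaming (interchange to medial)

  -- The two sides are the bounds from above and below for the number of distinct members of O, times q = p ^ h.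
  rank<count : ∀ p' k .{{_ : NonZero p'}} .{{_ : NonZero k}} → ∃ λ r₀ → ∀ r → r₀ ≤ r → ∀ h .{{_ : NonZero h}} →
    (suc (((r + r) ^ p') ^ h) ^ k) ^ k * (suc p' ^ h) < (suc p' ^ h) ^ r
  -- The successor pays for the factor `suc p' ^ h` on the left, which uses up one of the r factors
  -- on the right.
  rank<count p' k = suc (proj₁ lin) , bound
    where
    d = p' * (k * k)
    instance
      k*k≢0 : NonZero (k * k)
      k*k≢0 = m*n≢0 k k
      d≢0 : NonZero d
      d≢0 = m*n≢0 p' (k * k)
    lin = linear^d<2^ d
    open ≤-Reasoning
    bound : ∀ r → suc (proj₁ lin) ≤ r → ∀ h .{{_ : NonZero h}} →
      (suc (((r + r) ^ p') ^ h) ^ k) ^ k * (suc p' ^ h) < (suc p' ^ h) ^ r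
    bound (suc s) (s≤s r₀≤s) h = begin-strict
      (suc (((r + r) ^ p') ^ h) ^ k) ^ k * p ^ h    ≡⟨ cong (_* p ^ h) (^-*-assoc (suc (((r + r) ^ p') ^ h)) k k) ⟩
      suc (((r + r) ^ p') ^ h) ^ (k * k) * p ^ h    ≤⟨ *-monoˡ-≤ (p ^ h) (^-monoˡ-≤ (k * k) step) ⟩
      ((suc (r + r) ^ p') ^ h) ^ (k * k) * p ^ h    ≡⟨ cong (_* p ^ h) (trans (^-*-assoc _ h (k * k)) (trans (cong ((suc (r + r) ^ p') ^_) (*-comm h (k * k))) (sym (^-*-assoc _ (k * k) h)))) ⟩
      ((suc (r + r) ^ p') ^ (k * k)) ^ h * p ^ h    ≡⟨ cong (λ z → z ^ h * p ^ h) (^-*-assoc (suc (r + r)) p' (k * k)) ⟩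
      (suc (r + r) ^ d) ^ h * p ^ h                 ≡⟨ sym (^-distribʳ-* h (suc (r + r) ^ d) p) ⟩
      (suc (r + r) ^ d * p) ^ h                     <⟨ ^-monoˡ-< h (*-monoˡ-< p core) ⟩
      (p ^ s * p) ^ h                               ≡⟨ cong (_^ h) (*-comm (p ^ s) p) ⟩
      (p ^ r) ^ h                                   ≡⟨ trans (^-*-assoc p r h) (trans (cong (p ^_) (*-comm r h)) (sym (^-*-assoc p h r))) ⟩
      (p ^ h) ^ r                                   ∎
      where
      r = suc s
      p = suc p'
      step : suc (((r + r) ^ p') ^ h) ≤ (suc (r + r) ^ p') ^ h
      step = ≤-trans (1+x^n≤[1+x]^n ((r + r) ^ p') h) (^-monoˡ-≤ h (1+x^n≤[1+x]^n (r + r) p'))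
      core : suc (r + r) ^ d < p ^ s
      core = begin-strict
        suc (r + r) ^ d       ≡⟨ cong (λ z → suc (suc z) ^ d) (+-suc s s) ⟩
        (3 + (s + s)) ^ d     <⟨ proj₂ lin s r₀≤s ⟩
        2 ^ s                 ≤⟨ ^-monoˡ-≤ s (s≤s (>-nonZero⁻¹ p')) ⟩
        p ^ s                 ∎

open Arithmetic using (prime∣C; rank<count)

module _ {c ℓ} (M : CommutativeMonoid c ℓ) where
  open CommutativeMonoid M renaming (Carrier to A; trans to ≈-trans; refl to ≈-refl)
  open import Algebra.Properties.CommutativeMonoid.Sum M

  sum-single : ∀ {n} (i : Fin n) (f : Fin n → A) → (∀ j → j ≢ i → f j ≈ ε) → sum f ≈ f i
  sum-single {suc n} i f f≈ε =
    ≈-trans (sum-remove {i = i} f)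
      (≈-trans (∙-congˡ (≈-trans (sum-cong-≋ (λ j → f≈ε (punchIn i j) (Fin.punchInᵢ≢i i j))) (sum-replicate-zero n)))
             (identityʳ (f i)))

-- Finite fields: decidable equality, Fermat's theorem and the Frobenius map.

module FieldTheory {q : ℕ} (F : FiniteField q) where
  open FiniteField F public

  ring : CommutativeRing 0ℓ 0ℓ
  ring = record { isCommutativeRing = isCommutativeRing }

  open CommutativeRing ring public using
    ( +-assoc; +-comm; +-identityˡ; +-identityʳ; -‿inverseˡ; -‿inverseʳ; *-assoc; *-comm; *-identityˡ; *-identityʳ
    ; distribˡ; distribʳ; zeroˡ; zeroʳ; +-commutativeMonoid; *-commutativeMonoid; semiring; commutativeSemiring)
  open CommutativeRing ring using (+-group)
  open import Algebra.Properties.Ring (CommutativeRing.ring ring) public using (-‿distribˡ-*; -‿distribʳ-*; -0#≈0#; -‿involutive)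
  open import Algebra.Properties.Group +-group public using () renaming (∙-cancelˡ to +-cancelˡ; ∙-cancelʳ to +-cancelʳ; inverseˡ-unique to -‿uniqueˡ; inverseʳ-unique to -‿uniqueʳ)
  open import Algebra.Properties.CommutativeSemigroup (CommutativeRing.+-commutativeSemigroup ring) public using () renaming (interchange to +-interchange)
  open import Algebra.Properties.CommutativeSemigroup (CommutativeRing.*-commutativeSemigroup ring) public using () renaming (interchange to *-interchange)
  open import Algebra.Properties.Semiring.Exp semiring public using (_^_; ^-assocʳ)
  open import Algebra.Properties.CommutativeSemiring.Exp commutativeSemiring public using (^-distrib-*)

  additive-0 : (φ : Carrier → Carrier) → (∀ x y → φ (x + y) ≡ φ x + φ y) → φ 0# ≡ 0#
  additive-0 φ φ+ = +-cancelˡ (φ 0#) _ _ (trans (sym (φ+ 0# 0#)) (trans (cong φ (+-identityʳ 0#)) (sym (+-identityʳ _))))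

  additive-neg : (φ : Carrier → Carrier) → (∀ x y → φ (x + y) ≡ φ x + φ y) → ∀ x → φ (- x) ≡ - φ x
  additive-neg φ φ+ x = -‿uniqueˡ _ _ (trans (sym (φ+ (- x) x)) (trans (cong φ (-‿inverseˡ x)) (additive-0 φ φ+)))

  toC : Fin q → Carrier
  toC = Inverse.to enumeration

  fromC : Carrier → Fin q
  fromC = Inverse.from enumeration

  toC-fromC : ∀ x → toC (fromC x) ≡ x
  toC-fromC = Inverse.strictlyInverseˡ enumeration

  fromC-toC : ∀ i → fromC (toC i) ≡ i
  fromC-toC = Inverse.strictlyInverseʳ enumeration

  fromC-injective : ∀ {x y} → fromC x ≡ fromC y → x ≡ y
  fromC-injective {x} {y} eq = trans (sym (toC-fromC x)) (trans (cong toC eq) (toC-fromC y))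

  infix 4 _≟_
  _≟_ : DecidableEquality Carrier
  x ≟ y = map′ fromC-injective (cong fromC) (fromC x Fin.≟ fromC y)

  1<q : 1 ℕ.< q
  1<q = go q (fromC 0#) (fromC 1#) (0≢1 ∘ fromC-injective)
    where
    go : ∀ n (i j : Fin n) → i ≢ j → 1 ℕ.< n
    go (suc zero)    zero zero i≢j = contradiction refl i≢j
    go (suc (suc n)) _    _    _   = ℕ.s≤s (ℕ.s≤s ℕ.z≤n)

  *-cancelˡ : ∀ {x y z} → x ≢ 0# → x * y ≡ x * z → y ≡ z
  *-cancelˡ {x} {y} {z} x≢0 eq with inverse x x≢0
  ... | x⁻¹ , xx⁻¹≡1 = trans (sym (undo y)) (trans (cong (x⁻¹ *_) eq) (undo z))
    where
    undo : ∀ w → x⁻¹ * (x * w) ≡ w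
    undo w = trans (sym (*-assoc x⁻¹ x w)) (trans (cong (_* w) (trans (*-comm x⁻¹ x) xx⁻¹≡1)) (*-identityˡ w))

  x*y≡0⇒y≡0 : ∀ {x y} → x ≢ 0# → x * y ≡ 0# → y ≡ 0#
  x*y≡0⇒y≡0 {x} x≢0 eq = *-cancelˡ x≢0 (trans eq (sym (zeroʳ x)))

  ^-nonzero : ∀ {x} n → x ^ n ≡ 0# → x ≡ 0#
  ^-nonzero zero eq = contradiction (sym eq) 0≢1
  ^-nonzero {x} (suc n) eq with x ≟ 0#
  ... | yes x≡0 = x≡0
  ... | no  x≢0 = ^-nonzero n (x*y≡0⇒y≡0 x≢0 eq)

  module _ where
    open import Algebra.Properties.CommutativeMonoid.Sum *-commutativeMonoid

    private
      -- Multiplication by y permutes the nonzero elements; the value at 0# is replaced by 1# so that all products run over F.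
      g : Carrier → Carrier
      g x with x ≟ 0#
      ... | yes _ = 1#
      ... | no  _ = x

      scale pad : Carrier → Carrier → Carrier
      scale y x with x ≟ 0#
      ... | yes _ = 1#
      ... | no  _ = y
      pad y x with x ≟ 0#
      ... | yes _ = y
      ... | no  _ = 1#

      g-* : ∀ {y} → y ≢ 0# → ∀ x → g (y * x) ≡ scale y x * g x
      g-* {y} y≢0 x with x ≟ 0# | y * x ≟ 0#
      ... | yes _   | yes _    = sym (*-identityˡ 1#)
      ... | yes x≡0 | no  yx≢0 = contradiction (trans (cong (y *_) x≡0) (zeroʳ y)) yx≢0
      ... | no  x≢0 | yes yx≡0 = contradiction (x*y≡0⇒y≡0 y≢0 yx≡0) x≢0
      ... | no  _   | no  _    = refl

      pad-* : ∀ y x → y ≡ scale y x * pad y x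
      pad-* y x with x ≟ 0#
      ... | yes _ = sym (*-identityˡ y)
      ... | no  _ = sym (*-identityʳ y)

      pad-0 : ∀ y x → x ≡ 0# → pad y x ≡ y
      pad-0 y x x≡0 with x ≟ 0#
      ... | yes _   = refl
      ... | no  x≢0 = contradiction x≡0 x≢0

      pad-≢0 : ∀ y x → x ≢ 0# → pad y x ≡ 1#
      pad-≢0 y x x≢0 with x ≟ 0#
      ... | yes x≡0 = contradiction x≡0 x≢0
      ... | no  _   = refl

      g≢0 : ∀ x → g x ≢ 0#
      g≢0 x with x ≟ 0#
      ... | yes _   = 0≢1 ∘ sym
      ... | no  x≢0 = x≢0

      product≢0 : ∀ {n} (f : Fin n → Carrier) → (∀ i → f i ≢ 0#) → sum f ≢ 0#
      product≢0 {zero}  f f≢0 eq = 0≢1 (sym eq)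
      product≢0 {suc n} f f≢0 eq = product≢0 (f ∘ suc) (f≢0 ∘ suc) (x*y≡0⇒y≡0 (f≢0 zero) eq)

    -- Write y^q as a product of y over all field elements x and split each factor: `scale` keeps
    -- the y at nonzero x, `pad` keeps the one at zero. The first product is 1, because
    -- multiplication by y permutes the nonzero elements; the second is y.
    fermat : ∀ {y} → y ≢ 0# → y ^ q ≡ y
    fermat {y} y≢0 with inverse y y≢0
    ... | y⁻¹ , yy⁻¹≡1 = begin
      y ^ q                                              ≡⟨ sym (sum-replicate q) ⟩
      sum {q} (λ _ → y)                                  ≡⟨ sum-cong-≗ (λ i → pad-* y (toC i)) ⟩
      sum (λ i → scale y (toC i) * pad y (toC i))        ≡⟨ ∑-distrib-+ (scale y ∘ toC) (pad y ∘ toC) ⟩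
      sum (scale y ∘ toC) * sum (pad y ∘ toC)            ≡⟨ cong₂ _*_ scale≡1 pad≡y ⟩
      1# * y                                             ≡⟨ *-identityˡ y ⟩
      y                                                  ∎
      where
      open ≡-Reasoning
      inv : ∀ a b → a * b ≡ 1# → ∀ i → fromC (a * toC (fromC (b * toC i))) ≡ i
      inv a b ab≡1 i = trans (cong fromC (begin
        a * toC (fromC (b * toC i)) ≡⟨ cong (a *_) (toC-fromC _) ⟩
        a * (b * toC i)             ≡⟨ sym (*-assoc a b _) ⟩
        a * b * toC i               ≡⟨ cong (_* toC i) ab≡1 ⟩
        1# * toC i                  ≡⟨ *-identityˡ _ ⟩
        toC i                       ∎)) (fromC-toC i)
      π = permutation (λ i → fromC (y * toC i)) (λ i → fromC (y⁻¹ * toC i))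
            (inv y y⁻¹ yy⁻¹≡1) (inv y⁻¹ y (trans (*-comm y⁻¹ y) yy⁻¹≡1))
      scale≡1 : sum (scale y ∘ toC) ≡ 1#
      scale≡1 = *-cancelˡ (product≢0 (g ∘ toC) (g≢0 ∘ toC)) (begin
        sum (g ∘ toC) * sum (scale y ∘ toC)          ≡⟨ *-comm _ _ ⟩
        sum (scale y ∘ toC) * sum (g ∘ toC)          ≡⟨ sym (∑-distrib-+ (scale y ∘ toC) (g ∘ toC)) ⟩
        sum (λ i → scale y (toC i) * g (toC i))      ≡⟨ sum-cong-≗ (λ i → sym (trans (cong g (toC-fromC _)) (g-* y≢0 (toC i)))) ⟩
        sum (λ i → g (toC (fromC (y * toC i))))      ≡⟨ sym (sum-permute (g ∘ toC) π) ⟩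
        sum (g ∘ toC)                                ≡⟨ sym (*-identityʳ _) ⟩
        sum (g ∘ toC) * 1#                           ∎)
      pad≡y : sum (pad y ∘ toC) ≡ y
      pad≡y = trans (sum-single *-commutativeMonoid (fromC 0#) (pad y ∘ toC)
                      (λ j j≢ → pad-≢0 y (toC j) (λ eq → j≢ (trans (sym (fromC-toC j)) (cong fromC eq)))))
                    (pad-0 y _ (toC-fromC 0#))

  -- `τ` is the map with β(y,x) = τ(β(x,y)). The sign ε is 1 for quadratic and Hermitian forms and
  -- -1 for symplectic ones.
  module Conjugation (σ : Carrier → Carrier) (σ-+ : ∀ x y → σ (x + y) ≡ σ x + σ y) (σ-* : ∀ x y → σ (x * y) ≡ σ x * σ y)
    (σ-σ : ∀ x → σ (σ x) ≡ x) (ε : Carrier) (ε*ε≡1 : ε * ε ≡ 1#) (σ-ε : σ ε ≡ ε) where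
    open ≡-Reasoning

    τ : Carrier → Carrier
    τ x = ε * σ x

    τ-+ : ∀ x y → τ (x + y) ≡ τ x + τ y
    τ-+ x y = trans (cong (ε *_) (σ-+ x y)) (distribˡ _ _ _)

    τ-0 : τ 0# ≡ 0#
    τ-0 = additive-0 τ τ-+

    τ-neg : ∀ x → τ (- x) ≡ - τ x
    τ-neg = additive-neg τ τ-+

    τ-τ : ∀ x → τ (τ x) ≡ x
    τ-τ x = begin
      ε * σ (ε * σ x)      ≡⟨ cong (ε *_) (trans (σ-* ε (σ x)) (cong₂ _*_ σ-ε (σ-σ x))) ⟩
      ε * (ε * x)          ≡⟨ sym (*-assoc _ _ _) ⟩
      ε * ε * x            ≡⟨ cong (_* x) ε*ε≡1 ⟩
      1# * x               ≡⟨ *-identityˡ x ⟩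
      x                    ∎

    τ-injective : ∀ {x y} → τ x ≡ τ y → x ≡ y
    τ-injective eq = trans (sym (τ-τ _)) (trans (cong τ eq) (τ-τ _))

    τ-*σ : ∀ a x → τ (a * x) ≡ σ a * τ x
    τ-*σ a x = trans (cong (ε *_) (σ-* a x)) (trans (sym (*-assoc _ _ _)) (trans (cong (_* σ x) (*-comm ε (σ a))) (*-assoc _ _ _)))

  module Frobenius (p h : ℕ) (pr : Prime p) (q≡p^h : q ≡ p ℕ.^ h) where
    open import Algebra.Properties.CommutativeMonoid.Sum +-commutativeMonoid
    open import Algebra.Properties.Semiring.Mult semiring renaming (_×_ to infixr 8 _·1_)
    open import Algebra.Properties.CommutativeSemiring.Binomial commutativeSemiring using (binomialTerm; theorem)
    open ≡-Reasoning

    -- Translation by 1 permutes the field, so the sum of all elements does not change when q ones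
    -- are added to it.
    q·1≡0 : q ·1 1# ≡ 0#
    q·1≡0 = sym (+-cancelˡ (sum toC) _ _ (begin
      sum toC + 0#                          ≡⟨ +-identityʳ _ ⟩
      sum toC                               ≡⟨ sum-permute toC π ⟩
      sum (λ i → toC (fromC (toC i + 1#)))  ≡⟨ sum-cong-≗ (λ i → toC-fromC (toC i + 1#)) ⟩
      sum (λ i → toC i + 1#)                ≡⟨ ∑-distrib-+ toC (λ _ → 1#) ⟩
      sum toC + sum {q} (λ _ → 1#)          ≡⟨ cong (sum toC +_) (sum-replicate q) ⟩
      sum toC + q ·1 1#                     ∎))
      where
      inv : ∀ a b → b + a ≡ 0# → ∀ i → fromC (toC (fromC (toC i + b)) + a) ≡ i
      inv a b eq i = trans (cong fromC (begin
        toC (fromC (toC i + b)) + a  ≡⟨ cong (_+ a) (toC-fromC _) ⟩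
        toC i + b + a                ≡⟨ +-assoc _ b a ⟩
        toC i + (b + a)              ≡⟨ cong (toC i +_) eq ⟩
        toC i + 0#                   ≡⟨ +-identityʳ _ ⟩
        toC i                        ∎)) (fromC-toC i)
      π = permutation (λ i → fromC (toC i + 1#)) (λ i → fromC (toC i + - 1#))
            (inv 1# (- 1#) (-‿inverseˡ 1#)) (inv (- 1#) 1# (-‿inverseʳ 1#))

    -- The h-th power of p·1 is q·1, which vanishes, and a field has no nonzero nilpotents.
    p·1≡0 : p ·1 1# ≡ 0#
    p·1≡0 = ^-nonzero h (trans (sym (homo h)) (trans (cong (_·1 1#) (sym q≡p^h)) q·1≡0))
      where
      homo : ∀ n → (p ℕ.^ n) ·1 1# ≡ (p ·1 1#) ^ n
      homo zero    = +-identityʳ 1#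
      homo (suc n) = trans (×1-homo-* p (p ℕ.^ n)) (cong (p ·1 1# *_) (homo n))

    p∣⇒·≡0 : ∀ {n} → p ∣ n → ∀ x → n ·1 x ≡ 0#
    p∣⇒·≡0 (divides m refl) x = begin
      (m ℕ.* p) ·1 x            ≡⟨ sym (×-assocˡ x m p) ⟩
      m ·1 p ·1 x               ≡⟨ cong (m ·1_) (begin
        p ·1 x                    ≡⟨ cong (p ·1_) (sym (*-identityˡ x)) ⟩
        p ·1 (1# * x)             ≡⟨ sym (×-assoc-* p 1# x) ⟩
        p ·1 1# * x               ≡⟨ cong (_* x) p·1≡0 ⟩
        0# * x                    ≡⟨ zeroˡ x ⟩
        0#                        ∎) ⟩
      m ·1 0#                   ≡⟨ trans (sym (sum-replicate m)) (sum-replicate-zero m) ⟩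
      0#                        ∎

    frobenius-+ : ∀ x y → (x + y) ^ p ≡ x ^ p + y ^ p
    frobenius-+ x y = trans (theorem p x y) (expand p refl)
      where
      expand : ∀ n → n ≡ p → sum {suc n} (binomialTerm x y n) ≡ x ^ n + y ^ n
      expand zero    refl = contradiction pr λ ()
      expand (suc n) refl = begin
        binomialTerm x y (suc n) zero + sum {suc n} (binomialTerm x y (suc n) ∘ suc)
          ≡⟨ cong₂ _+_ (trans (+-identityʳ _) (*-identityˡ _))
               (trans (sum-single +-commutativeMonoid (fromℕ n) (binomialTerm x y (suc n) ∘ suc) middle) last) ⟩
        y ^ suc n + x ^ suc n    ≡⟨ +-comm _ _ ⟩
        x ^ suc n + y ^ suc n    ∎
        where
        middle : ∀ j → j ≢ fromℕ n → binomialTerm x y (suc n) (suc j) ≡ 0#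
        middle j j≢ = p∣⇒·≡0 (prime∣C pr (suc (toℕ j)) ℕ.z<s (ℕ.s<s
          (ℕ.≤∧≢⇒< (ℕ.≤-pred (Fin.toℕ<n j)) λ eq → j≢ (Fin.toℕ-injective (trans eq (sym (Fin.toℕ-fromℕ n))))))) _
        last : binomialTerm x y (suc n) (suc (fromℕ n)) ≡ x ^ suc n
        last rewrite Fin.toℕ-fromℕ n | nCn≡1 (suc n) | ℕ.n∸n≡0 n = trans (+-identityʳ _) (*-identityʳ _)

-- Counting: encodings of functions and maximal separated sets.

funToFin-injective : ∀ {m n} (f g : Fin m → Fin n) → funToFin f ≡ funToFin g → ∀ i → f i ≡ g i
funToFin-injective f g eq i = trans (sym (Fin.finToFun-funToFin f i))
  (trans (cong (λ z → finToFun z i) eq) (Fin.finToFun-funToFin g i))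

funToFin-cong : ∀ {m n} {f g : Fin m → Fin n} → (∀ i → f i ≡ g i) → funToFin f ≡ funToFin g
funToFin-cong {zero}  _  = refl
funToFin-cong {suc m} eq = cong₂ Fin.combine (eq zero) (funToFin-cong (eq ∘ suc))

-- The factor `N` cancels from the two cardinalities. It will be the number of all matrices, so a
-- proportion is bounded without dividing.
factor-≤ : ∀ {U N S Q} .{{_ : ℕ.NonZero N}} (g : Fin U × Fin N → Fin S × Fin N × Fin Q) →
  Injective _≡_ _≡_ g → U ℕ.≤ S ℕ.* Q
factor-≤ {U} {N} {S} {Q} g g-inj = ℕ.*-cancelʳ-≤ U (S ℕ.* Q) N (ℕ.≤-trans (Fin.injective⇒≤ {f = code} code-injective)
  (ℕ.≤-reflexive (trans (cong (S ℕ.*_) (ℕ.*-comm N Q)) (sym (ℕ.*-assoc S Q N)))))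
  where
  pair : Fin S × Fin N × Fin Q → Fin (S ℕ.* (N ℕ.* Q))
  pair (s , a , b) = Fin.combine s (Fin.combine a b)
  pair-injective : Injective _≡_ _≡_ pair
  pair-injective {s , a , b} {s′ , a′ , b′} eq
    with refl , eq′ ← Fin.combine-injective s _ s′ _ eq
    with refl , refl ← Fin.combine-injective a b a′ b′ eq′ = refl
  code : Fin (U ℕ.* N) → Fin (S ℕ.* (N ℕ.* Q))
  code z = pair (g (Fin.remQuot {U} N z))
  code-injective : Injective _≡_ _≡_ code
  code-injective {z} {z′} eq = trans (sym (Fin.combine-remQuot {U} N z)) (trans
    (cong (λ (u , a) → Fin.combine u a) (g-inj (pair-injective eq))) (Fin.combine-remQuot {U} N z′))

-- A maximal set of pairwise unrelated elements rather than a system of class representatives, since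
-- orthogonality of spaces is evidently reflexive and symmetric here, but not evidently transitive.
record Transversal {N} (_~_ : Fin N → Fin N → Set) : Set where
  field
    size       : ℕ
    member     : Fin size → Fin N
    separated  : ∀ {i j} → i ≢ j → ¬ (member i ~ member j)
    rep        : Fin N → Fin size
    rep-~      : ∀ a → a ~ member (rep a)

transversal : ∀ {N} (_~_ : Fin N → Fin N → Set) → Decidable _~_ →
  (∀ a → a ~ a) → (∀ {a b} → a ~ b → b ~ a) → Transversal _~_
transversal {zero} _~_ dec ~-refl ~-sym = record
  { size = 0 ; member = λ () ; separated = λ { {()} } ; rep = λ () ; rep-~ = λ () }
transversal {suc N} _~_ dec ~-refl ~-sym
  with transversal (λ a b → suc a ~ suc b) (λ a b → dec (suc a) (suc b)) (~-refl ∘ suc) ~-sym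
... | T with Fin.any? (λ i → dec zero (suc (Transversal.member T i)))
... | yes (i , 0~i) = record
  { size = size ; member = suc ∘ member ; separated = separated
  ; rep = λ { zero → i ; (suc a) → rep a } ; rep-~ = λ { zero → 0~i ; (suc a) → rep-~ a } }
  where open Transversal T
... | no 0≁ = record
  { size = suc size ; member = λ { zero → zero ; (suc i) → suc (member i) }
  ; separated = λ { {zero} {zero} i≢j → contradiction refl i≢j
                  ; {zero} {suc j} _ 0~j → 0≁ (j , 0~j)
                  ; {suc i} {zero} _ i~0 → 0≁ (i , ~-sym i~0)
                  ; {suc i} {suc j} i≢j → separated (i≢j ∘ cong suc) }
  ; rep = λ { zero → zero ; (suc a) → suc (rep a) } ; rep-~ = λ { zero → ~-refl zero ; (suc a) → rep-~ a } }
  where open Transversal T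

-- Finite sums, and matrices that are sums of few separable terms.

module LinearTheory {q : ℕ} (F : FiniteField q) where
  open FieldTheory F public
  open ≡-Reasoning

  Σ′ : ∀ {m} → (Fin m → Carrier) → Carrier
  Σ′ = ∑ F

  ∑-cong : ∀ {m} {f g : Fin m → Carrier} → (∀ i → f i ≡ g i) → Σ′ f ≡ Σ′ g
  ∑-cong {zero}  f≗g = refl
  ∑-cong {suc m} f≗g = cong₂ _+_ (f≗g zero) (∑-cong (f≗g ∘ suc))

  ∑-zero : ∀ {m} {f : Fin m → Carrier} → (∀ i → f i ≡ 0#) → Σ′ f ≡ 0#
  ∑-zero {zero}  f≗0 = refl
  ∑-zero {suc m} f≗0 = trans (cong₂ _+_ (f≗0 zero) (∑-zero (f≗0 ∘ suc))) (+-identityʳ 0#)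

  ∑-+ : ∀ {m} (f g : Fin m → Carrier) → Σ′ (λ i → f i + g i) ≡ Σ′ f + Σ′ g
  ∑-+ {zero}  f g = sym (+-identityʳ 0#)
  ∑-+ {suc m} f g = trans (cong (f zero + g zero +_) (∑-+ (f ∘ suc) (g ∘ suc))) (+-interchange _ _ _ _)

  ∑-hom : (φ : Carrier → Carrier) → φ 0# ≡ 0# → (∀ x y → φ (x + y) ≡ φ x + φ y) →
    ∀ {m} (f : Fin m → Carrier) → φ (Σ′ f) ≡ Σ′ (φ ∘ f)
  ∑-hom φ φ0 φ+ {zero}  f = φ0
  ∑-hom φ φ0 φ+ {suc m} f = trans (φ+ _ _) (cong (φ (f zero) +_) (∑-hom φ φ0 φ+ (f ∘ suc)))

  ∑-*ˡ : ∀ x {m} (f : Fin m → Carrier) → x * Σ′ f ≡ Σ′ (λ i → x * f i)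
  ∑-*ˡ x = ∑-hom (x *_) (zeroʳ x) (distribˡ x)

  ∑-*ʳ : ∀ x {m} (f : Fin m → Carrier) → Σ′ f * x ≡ Σ′ (λ i → f i * x)
  ∑-*ʳ x = ∑-hom (_* x) (zeroˡ x) (distribʳ x)

  ∑-swap : ∀ {m n} (f : Fin m → Fin n → Carrier) → Σ′ (λ i → Σ′ (f i)) ≡ Σ′ (λ j → Σ′ (λ i → f i j))
  ∑-swap {zero} {n} f = sym (∑-zero {n} (λ _ → refl))
  ∑-swap {suc m} f = trans (cong (Σ′ (f zero) +_) (∑-swap (f ∘ suc))) (sym (∑-+ (f zero) _))

  ∑-single : ∀ {m} (i : Fin m) (f : Fin m → Carrier) → (∀ j → j ≢ i → f j ≡ 0#) → Σ′ f ≡ f i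
  ∑-single zero    f f≡0 = trans (cong (f zero +_) (∑-zero (λ j → f≡0 (suc j) λ ()))) (+-identityʳ _)
  ∑-single (suc i) f f≡0 = trans (cong₂ _+_ (f≡0 zero λ ()) (∑-single i (f ∘ suc) (λ j j≢i → f≡0 (suc j) (j≢i ∘ Fin.suc-injective)))) (+-identityˡ _)

  ∑-cancel : ∀ {m} (i : Fin m) (f g : Fin m → Carrier) → (∀ j → j ≢ i → f j ≡ g j) → Σ′ f ≡ Σ′ g → f i ≡ g i
  ∑-cancel zero f g f≡g eq =
    +-cancelʳ (Σ′ (g ∘ suc)) _ _ (trans (cong (f zero +_) (sym (∑-cong λ j → f≡g (suc j) λ ()))) eq)
  ∑-cancel (suc i) f g f≡g eq = ∑-cancel i (f ∘ suc) (g ∘ suc) (λ j j≢i → f≡g (suc j) (j≢i ∘ Fin.suc-injective))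
    (+-cancelˡ (g zero) _ _ (trans (cong (_+ Σ′ (f ∘ suc)) (sym (f≡g zero λ ()))) eq))

  ∑-splitAt : ∀ a {b} (f : Fin a → Carrier) (g : Fin b → Carrier) →
    Σ′ ([ f , g ]′ ∘ splitAt a) ≡ Σ′ f + Σ′ g
  ∑-splitAt zero    f g = sym (+-identityˡ _)
  ∑-splitAt (suc a) f g = trans (cong (f zero +_) (trans (∑-cong lemma) (∑-splitAt a (f ∘ suc) g))) (sym (+-assoc _ _ _))
    where
    lemma : ∀ i → [ f , g ]′ (splitAt (suc a) (suc i)) ≡ [ f ∘ suc , g ]′ (splitAt a i)
    lemma i with splitAt a i
    ... | inj₁ _ = refl
    ... | inj₂ _ = refl

  δ : ∀ {m} → Fin m → Fin m → Carrier
  δ i j with i Fin.≟ j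
  ... | yes _ = 1#
  ... | no  _ = 0#

  δ-refl : ∀ {m} (i : Fin m) → δ i i ≡ 1#
  δ-refl i with i Fin.≟ i
  ... | yes _   = refl
  ... | no  i≢i = contradiction refl i≢i

  δ-≢ : ∀ {m} {i j : Fin m} → i ≢ j → δ i j ≡ 0#
  δ-≢ {i = i} {j} i≢j with i Fin.≟ j
  ... | yes i≡j = contradiction i≡j i≢j
  ... | no  _   = refl

  δ-sym : ∀ {m} (i j : Fin m) → δ i j ≡ δ j i
  δ-sym i j with i Fin.≟ j
  ... | yes refl = sym (δ-refl i)
  ... | no  i≢j  = sym (δ-≢ (i≢j ∘ sym))

  ∑-δˡ : ∀ {m} (i : Fin m) (f : Fin m → Carrier) → Σ′ (λ j → δ i j * f j) ≡ f i
  ∑-δˡ i f = trans (∑-single i _ (λ j j≢i → trans (cong (_* f j) (δ-≢ (j≢i ∘ sym))) (zeroˡ _)))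
    (trans (cong (_* f i) (δ-refl i)) (*-identityˡ _))

  ∑-δʳ : ∀ {m} (i : Fin m) (f : Fin m → Carrier) → Σ′ (λ j → f j * δ j i) ≡ f i
  ∑-δʳ i f = trans (∑-cong (λ j → trans (*-comm _ _) (cong (_* f j) (δ-sym j i)))) (∑-δˡ i f)

  encV : ∀ {m} → (Fin m → Carrier) → Fin (q ℕ.^ m)
  encV v = funToFin (fromC ∘ v)

  decV : ∀ {m} → Fin (q ℕ.^ m) → Fin m → Carrier
  decV a = toC ∘ finToFun a

  encV-injective : ∀ {m} {v w : Fin m → Carrier} → encV v ≡ encV w → ∀ i → v i ≡ w i
  encV-injective eq i = fromC-injective (funToFin-injective _ _ eq i)

  decV-injective : ∀ {m} {a b : Fin (q ℕ.^ m)} → (∀ i → decV a i ≡ decV b i) → a ≡ b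
  decV-injective {m} {a} {b} eq = trans (sym (Fin.funToFin-finToFin {m} a)) (trans (funToFin-cong same) (Fin.funToFin-finToFin {m} b))
    where
    same : ∀ i → finToFun {q} {m} a i ≡ finToFun b i
    same i = fromC-toC⁻ (eq i)
      where
      fromC-toC⁻ : ∀ {k l} → toC k ≡ toC l → k ≡ l
      fromC-toC⁻ {k} {l} e = trans (sym (fromC-toC k)) (trans (cong fromC e) (fromC-toC l))

  module _ {I J : Set} where

    -- Rank at most `R`, expressed as a factorisation through F^R. Products and powers of matrices
    -- are taken entrywise throughout, and the bounds multiply under them.
    LowRank : ℕ → (I → J → Carrier) → Set
    LowRank R m = Σ (Fin R → I → Carrier) λ φ → Σ (Fin R → J → Carrier) λ ψ →
      ∀ i j → m i j ≡ Σ′ (λ l → φ l i * ψ l j)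

    LowRank-cong : ∀ {R m m′} → (∀ i j → m′ i j ≡ m i j) → LowRank R m → LowRank R m′
    LowRank-cong eq (φ , ψ , m≡) = φ , ψ , λ i j → trans (eq i j) (m≡ i j)

    LowRank-separable : ∀ (φ : I → Carrier) (ψ : J → Carrier) → LowRank 1 (λ i j → φ i * ψ j)
    LowRank-separable φ ψ = (λ _ → φ) , (λ _ → ψ) , λ i j → sym (+-identityʳ _)

    LowRank-1 : LowRank 1 (λ _ _ → 1#)
    LowRank-1 = LowRank-cong (λ _ _ → sym (*-identityˡ 1#)) (LowRank-separable (λ _ → 1#) (λ _ → 1#))

    LowRank-+ : ∀ {R R′ m m′} → LowRank R m → LowRank R′ m′ → LowRank (R ℕ.+ R′) (λ i j → m i j + m′ i j)
    LowRank-+ {R} {R′} {m} {m′} (φ , ψ , m≡) (φ′ , ψ′ , m′≡) =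
      (λ l → [ φ , φ′ ]′ (splitAt R l)) , (λ l → [ ψ , ψ′ ]′ (splitAt R l)) , λ i j → begin
        m i j + m′ i j   ≡⟨ cong₂ _+_ (m≡ i j) (m′≡ i j) ⟩
        Σ′ (λ l → φ l i * ψ l j) + Σ′ (λ l → φ′ l i * ψ′ l j)   ≡⟨ sym (∑-splitAt R _ _) ⟩
        Σ′ ([ (λ l → φ l i * ψ l j) , (λ l → φ′ l i * ψ′ l j) ]′ ∘ splitAt R) ≡⟨ ∑-cong (λ l → distribute (splitAt R l) i j) ⟩
        Σ′ (λ l → [ φ , φ′ ]′ (splitAt R l) i * [ ψ , ψ′ ]′ (splitAt R l) j) ∎
      where
      distribute : ∀ (s : Fin R ⊎ Fin R′) i j →
        [ (λ l → φ l i * ψ l j) , (λ l → φ′ l i * ψ′ l j) ]′ s ≡ [ φ , φ′ ]′ s i * [ ψ , ψ′ ]′ s j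
      distribute (inj₁ _) i j = refl
      distribute (inj₂ _) i j = refl

    -- The map can be applied to both factors separately. A Frobenius twist thus leaves the bound
    -- unchanged, whereas `LowRank-^` would raise it to its p-th power.
    LowRank-hom : (θ : Carrier → Carrier) → θ 0# ≡ 0# → (∀ x y → θ (x + y) ≡ θ x + θ y) →
      (∀ x y → θ (x * y) ≡ θ x * θ y) → ∀ {R m} → LowRank R m → LowRank R (λ i j → θ (m i j))
    LowRank-hom θ θ0 θ+ θ* {R} (φ , ψ , m≡) = (λ l → θ ∘ φ l) , (λ l → θ ∘ ψ l) , λ i j →
      trans (cong θ (m≡ i j)) (trans (∑-hom θ θ0 θ+ {R} _) (∑-cong {R} (λ l → θ* _ _)))

    LowRank-separable-* : ∀ (α : I → Carrier) (β : J → Carrier) {R m} →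
      LowRank R m → LowRank R (λ i j → (α i * β j) * m i j)
    LowRank-separable-* α β {R} {m = m} (φ , ψ , m≡) = (λ l i → α i * φ l i) , (λ l j → β j * ψ l j) , λ i j →
      trans (cong (α i * β j *_) (m≡ i j)) (trans (∑-*ˡ (α i * β j) {R} _) (∑-cong {R} (λ l → *-interchange _ _ _ _)))

    LowRank-* : ∀ {R R′ m m′} → LowRank R m → LowRank R′ m′ → LowRank (R ℕ.* R′) (λ i j → m i j * m′ i j)
    LowRank-* {zero} {m′ = m′} (φ , ψ , m≡) _ =
      (λ ()) , (λ ()) , λ i j → trans (cong (_* m′ i j) (m≡ i j)) (zeroˡ _)
    LowRank-* {suc R} {m′ = m′} (φ , ψ , m≡) low′ =
      LowRank-cong (λ i j → trans (cong (_* m′ i j) (m≡ i j)) (distribʳ _ _ _))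
        (LowRank-+ (LowRank-separable-* (φ zero) (ψ zero) low′)
                   (LowRank-* ((φ ∘ suc) , (ψ ∘ suc) , λ _ _ → refl) low′))

    LowRank-^ : ∀ {R m} → LowRank R m → ∀ n → LowRank (R ℕ.^ n) (λ i j → m i j ^ n)
    LowRank-^ low zero    = LowRank-1
    LowRank-^ low (suc n) = LowRank-* low (LowRank-^ low n)

    LowRank-1- : ∀ {R m} → LowRank R m → LowRank (suc R) (λ i j → 1# + - m i j)
    LowRank-1- low = LowRank-+ LowRank-1
      (LowRank-cong (λ i j → trans (cong -_ (sym (*-identityˡ _))) (trans (-‿distribˡ-* _ _) (cong (_* _) (sym (*-identityʳ _)))))
        (LowRank-separable-* (λ _ → - 1#) (λ _ → 1#) low))

  ∏ : ∀ {k} → (Fin k → Carrier) → Carrier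
  ∏ {zero}  f = 1#
  ∏ {suc k} f = f zero * ∏ (f ∘ suc)

  ∏-one : ∀ {k} {f : Fin k → Carrier} → (∀ i → f i ≡ 1#) → ∏ f ≡ 1#
  ∏-one {zero}  f≡1 = refl
  ∏-one {suc k} f≡1 = trans (cong₂ _*_ (f≡1 zero) (∏-one (f≡1 ∘ suc))) (*-identityˡ 1#)

  ∏-zero : ∀ {k} {f : Fin k → Carrier} i → f i ≡ 0# → ∏ f ≡ 0#
  ∏-zero {f = f} zero    f≡0 = trans (cong (_* ∏ (f ∘ suc)) f≡0) (zeroˡ _)
  ∏-zero (suc i) f≡0 = trans (cong (_ *_) (∏-zero i f≡0)) (zeroʳ _)

  LowRank-∏ : ∀ {I J R k} {m : Fin k → I → J → Carrier} → (∀ a → LowRank R (m a)) →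
    LowRank (R ℕ.^ k) (λ i j → ∏ (λ a → m a i j))
  LowRank-∏ {k = zero}  low = LowRank-1
  LowRank-∏ {k = suc k} low = LowRank-* (low zero) (LowRank-∏ (low ∘ suc))

  -- c ↦ (Σ_i c_i φ_l(i))_l is injective from F^N to F^R, because c_j is recovered from it as Σ_l (Σ_i c_i φ_l(i)) ψ_l(j).
  identity-rank : ∀ {N R} {m : Fin N → Fin N → Carrier} → LowRank R m → (∀ i j → m i j ≡ δ i j) → N ℕ.≤ R
  identity-rank {N} {R} {m} (φ , ψ , m≡) m≡δ = ℕ.≮⇒≥ λ R<N →
    ℕ.<⇒≱ (ℕ.^-monoʳ-< q 1<q R<N) (Fin.injective⇒≤ {f = λ a → encV (image (decV {N} a))}
      (λ {a} {b} eq → decV-injective {N} (λ j → trans (sym (recover (decV a) j))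
        (trans (∑-cong {R} (λ l → cong (_* ψ l j) (encV-injective eq l))) (recover (decV b) j)))))
    where
    image : (Fin N → Carrier) → Fin R → Carrier
    image c l = Σ′ (λ i → c i * φ l i)
    recover : ∀ c j → Σ′ (λ l → image c l * ψ l j) ≡ c j
    recover c j = begin
      Σ′ (λ l → image c l * ψ l j)                 ≡⟨ ∑-cong {R} (λ l → ∑-*ʳ (ψ l j) {N} _) ⟩
      Σ′ (λ l → Σ′ (λ i → c i * φ l i * ψ l j))    ≡⟨ ∑-swap {R} {N} _ ⟩
      Σ′ (λ i → Σ′ (λ l → c i * φ l i * ψ l j))    ≡⟨ ∑-cong {N} (λ i → trans (∑-cong {R} (λ l → *-assoc _ _ _)) (sym (∑-*ˡ (c i) {R} _))) ⟩
      Σ′ (λ i → c i * Σ′ (λ l → φ l i * ψ l j))    ≡⟨ ∑-cong {N} (λ i → cong (c i *_) (trans (sym (m≡ i j)) (m≡δ i j))) ⟩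
      Σ′ (λ i → c i * δ i j)                       ≡⟨ ∑-δʳ j c ⟩
      c j                                          ∎

  module Indicator (p′ h : ℕ) (pr : Prime (suc p′)) .{{_ : ℕ.NonZero p′}} .{{_ : ℕ.NonZero h}} (q≡p^h : q ≡ suc p′ ℕ.^ h) where
    private p = suc p′
    open Frobenius p h pr q≡p^h

    -- y ^ (p ^ n ∸ 1), arranged so that additivity of the Frobenius map bounds its rank.
    χ : ℕ → Carrier → Carrier
    χ zero    y = 1#
    χ (suc n) y = y ^ p′ * χ n y ^ p

    y*χ : ∀ n y → y * χ n y ≡ y ^ (p ℕ.^ n)
    y*χ zero    y = refl
    y*χ (suc n) y = begin
      y * (y ^ p′ * χ n y ^ p)     ≡⟨ sym (*-assoc _ _ _) ⟩
      y ^ p * χ n y ^ p            ≡⟨ sym (^-distrib-* y (χ n y) p) ⟩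
      (y * χ n y) ^ p              ≡⟨ cong (_^ p) (y*χ n y) ⟩
      (y ^ (p ℕ.^ n)) ^ p          ≡⟨ ^-assocʳ y (p ℕ.^ n) p ⟩
      y ^ (p ℕ.^ n ℕ.* p)          ≡⟨ cong (y ^_) (ℕ.*-comm (p ℕ.^ n) p) ⟩
      y ^ (p ℕ.^ suc n)            ∎

    χ-nonzero : ∀ {y} → y ≢ 0# → χ h y ≡ 1#
    χ-nonzero {y} y≢0 = *-cancelˡ y≢0 (begin
      y * χ h y         ≡⟨ y*χ h y ⟩
      y ^ (p ℕ.^ h)     ≡⟨ cong (y ^_) (sym q≡p^h) ⟩
      y ^ q             ≡⟨ fermat y≢0 ⟩
      y                 ≡⟨ sym (*-identityʳ y) ⟩
      y * 1#            ∎)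

    χ-zero : χ h 0# ≡ 0#
    χ-zero = go h
      where
      0^ : ∀ n .{{_ : ℕ.NonZero n}} → 0# ^ n ≡ 0#
      0^ (suc n) = zeroˡ _
      go : ∀ n .{{_ : ℕ.NonZero n}} → χ n 0# ≡ 0#
      go (suc n) = trans (cong (_* χ n 0# ^ p) (0^ p′)) (zeroˡ _)

    LowRank-χ : ∀ {I J : Set} {R} {m : I → J → Carrier} → LowRank R m → ∀ n → LowRank ((R ℕ.^ p′) ℕ.^ n) (λ i j → χ n (m i j))
    LowRank-χ low zero    = LowRank-1
    LowRank-χ low (suc n) = LowRank-* (LowRank-^ low p′)
      (LowRank-hom (_^ p) (zeroˡ _) frobenius-+ (λ x y → ^-distrib-* x y p) (LowRank-χ low n))

    -- The indicator function of the zero matrix, in a form whose rank can be estimated factor by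
    -- factor.
    vanishing : ∀ {k} → (Fin k → Fin k → Carrier) → Carrier
    vanishing M = ∏ (λ a → ∏ (λ b → 1# + - χ h (M a b)))

    vanishing-yes : ∀ {k} {M : Fin k → Fin k → Carrier} → (∀ a b → M a b ≡ 0#) → vanishing M ≡ 1#
    vanishing-yes M≡0 = ∏-one (λ a → ∏-one (λ b → trans (cong (λ z → 1# + - z)
      (trans (cong (χ h) (M≡0 a b)) χ-zero)) (trans (cong (1# +_) -0#≈0#) (+-identityʳ 1#))))

    vanishing-no : ∀ {k} {M : Fin k → Fin k → Carrier} → ¬ (∀ a b → M a b ≡ 0#) → vanishing M ≡ 0#
    vanishing-no {k} {M} M≢0
      with Fin.¬∀⟶∃¬ k _ (λ a → Fin.all? (λ b → M a b ≟ 0#)) M≢0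
    ... | a , Ma≢0 with Fin.¬∀⟶∃¬ k _ (λ b → M a b ≟ 0#) Ma≢0
    ... | b , Mab≢0 = ∏-zero a (∏-zero b (trans (cong (λ z → 1# + - z) (χ-nonzero Mab≢0)) (-‿inverseʳ 1#)))

    -- `M a b s t` stands for β between the a-th basis vector of member s and the b-th of member t.
    -- For fixed a and b it is one matrix of low rank, and each of the k² pairs contributes one
    -- factor.
    separated-bound : ∀ {N R k} (M : Fin k → Fin k → Fin N → Fin N → Carrier) → (∀ a b → LowRank R (M a b)) →
      (∀ i a b → M a b i i ≡ 0#) → (∀ {i j} → i ≢ j → ¬ (∀ a b → M a b i j ≡ 0#)) →
      N ℕ.≤ (suc ((R ℕ.^ p′) ℕ.^ h) ℕ.^ k) ℕ.^ k
    separated-bound M low diagonal off = identity-rank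
      (LowRank-∏ (λ a → LowRank-∏ (λ b → LowRank-1- (LowRank-χ (low a b) h)))) λ i j → indicator i j
      where
      indicator : ∀ i j → vanishing (λ a b → M a b i j) ≡ δ i j
      indicator i j with i Fin.≟ j
      ... | yes refl = vanishing-yes (diagonal i)
      ... | no  i≢j  = vanishing-no (off i≢j)

-- Spans and linear independence.

module SpanTheory {q : ℕ} (F : FiniteField q) (n : ℕ) where
  open LinearTheory F public
  open ≡-Reasoning

  V : Set
  V = Vect F n

  infix 4 _≈_ _∈⟨_⟩ _⊑_
  _≈_ : V → V → Set
  _≈_ = _≋_ F

  infixl 6 _⊞_
  _⊞_ : V → V → V
  _⊞_ = _⊕_ F

  infixr 7 _·_
  _·_ : Carrier → V → V
  (a · x) j = a * x j

  0V : V
  0V = zeroV F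

  lin : ∀ {m} → (Fin m → V) → (Fin m → Carrier) → V
  lin = comb F

  _∈⟨_⟩ : ∀ {m} → V → (Fin m → V) → Set
  _∈⟨_⟩ = _∈Span_ F

  _⊑_ : ∀ {m m′} → (Fin m → V) → (Fin m′ → V) → Set
  _⊑_ = _⊆_ F

  lin-cong : ∀ {m} {B C : Fin m → V} {c d} → (∀ i → B i ≈ C i) → (∀ i → c i ≡ d i) → lin B c ≈ lin C d
  lin-cong B≈C c≗d j = ∑-cong (λ i → cong₂ _*_ (c≗d i) (B≈C i j))

  lin-δ : ∀ {m} (B : Fin m → V) i → lin B (δ i) ≈ B i
  lin-δ B i j = ∑-δˡ i (λ l → B l j)

  lin-+ : ∀ {m} (B : Fin m → V) c d → lin B (λ i → c i + d i) ≈ lin B c ⊞ lin B d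
  lin-+ {m} B c d j = trans (∑-cong {m} (λ i → distribʳ (B i j) (c i) (d i))) (∑-+ {m} _ _)

  lin-* : ∀ {m} (B : Fin m → V) a c → lin B (λ i → a * c i) ≈ a · lin B c
  lin-* {m} B a c j = trans (∑-cong {m} (λ i → *-assoc _ _ _)) (sym (∑-*ˡ a {m} _))

  lin-0 : ∀ {m} (B : Fin m → V) {c} → (∀ i → c i ≡ 0#) → lin B c ≈ 0V
  lin-0 B c≗0 j = ∑-zero (λ i → trans (cong (_* B i j) (c≗0 i)) (zeroˡ _))

  lin-lin : ∀ {m m′} (D : Fin m′ → V) (C : Fin m → Fin m′ → Carrier) c →
    lin (λ i → lin D (C i)) c ≈ lin D (λ l → Σ′ (λ i → c i * C i l))
  lin-lin {m} {m′} D C c j = begin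
    Σ′ (λ i → c i * Σ′ (λ l → C i l * D l j))        ≡⟨ ∑-cong {m} (λ i → trans (∑-*ˡ (c i) {m′} _) (∑-cong {m′} (λ l → sym (*-assoc _ _ _)))) ⟩
    Σ′ (λ i → Σ′ (λ l → c i * C i l * D l j))        ≡⟨ ∑-swap {m} {m′} _ ⟩
    Σ′ (λ l → Σ′ (λ i → c i * C i l * D l j))        ≡⟨ ∑-cong {m′} (λ l → sym (∑-*ʳ (D l j) {m} _)) ⟩
    Σ′ (λ l → Σ′ (λ i → c i * C i l) * D l j)        ∎

  ∈-member : ∀ {m} (B : Fin m → V) i → B i ∈⟨ B ⟩
  ∈-member B i = δ i , λ j → sym (lin-δ B i j)

  ∈-weaken : ∀ {m v} (B : Fin (suc m) → V) → v ∈⟨ B ∘ suc ⟩ → v ∈⟨ B ⟩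
  ∈-weaken {v = v} B (c , v≈) = (0# ∷ c) , λ j → trans (v≈ j) (sym (trans (cong (_+ lin (B ∘ suc) c j) (zeroˡ _)) (+-identityˡ _)))

  ∈-⊑ : ∀ {m m′ v} {B : Fin m → V} {D : Fin m′ → V} → v ∈⟨ B ⟩ → B ⊑ D → v ∈⟨ D ⟩
  ∈-⊑ {B = B} {D} (c , v≈) B⊑D = _ , λ j → trans (v≈ j)
    (trans (lin-cong {B = B} {c = c} (proj₂ ∘ B⊑D) (λ _ → refl) j) (lin-lin D (proj₁ ∘ B⊑D) c j))

  ⊑-refl : ∀ {m} {B : Fin m → V} → B ⊑ B
  ⊑-refl {B = B} = ∈-member B

  ⊑-trans : ∀ {m m′ m″} {B : Fin m → V} {C : Fin m′ → V} {D : Fin m″ → V} → B ⊑ C → C ⊑ D → B ⊑ D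
  ⊑-trans {C = C} {D} B⊑C C⊑D i = ∈-⊑ {B = C} {D} (B⊑C i) C⊑D

  independent-∷ : ∀ {m v} {G : Fin m → V} → LinIndep F G → ¬ (v ∈⟨ G ⟩) → LinIndep F (v ∷ G)
  independent-∷ {m} {v} {G} ind v∉ c c≈0 with c zero ≟ 0#
  ... | yes c₀≡0 = λ { zero → c₀≡0 ; (suc i) → ind (c ∘ suc) (λ j → trans (sym (+-identityˡ _))
          (trans (cong (_+ lin G (c ∘ suc) j) (sym (trans (cong (_* v j) c₀≡0) (zeroˡ _)))) (c≈0 j))) i }
  ... | no c₀≢0 with inverse (c zero) c₀≢0
  ... | a , c₀a≡1 = contradiction ((λ i → - a * c (suc i)) , λ j → sym (begin
          lin G (λ i → - a * c (suc i)) j        ≡⟨ lin-* G (- a) (c ∘ suc) j ⟩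
          - a * lin G (c ∘ suc) j                ≡⟨ cong (- a *_) (-‿uniqueʳ _ _ (c≈0 j)) ⟩
          - a * - (c zero * v j)                 ≡⟨ trans (sym (-‿distribˡ-* _ _)) (trans (cong -_ (sym (-‿distribʳ-* _ _))) (-‿involutive _)) ⟩
          a * (c zero * v j)                     ≡⟨ sym (*-assoc _ _ _) ⟩
          a * c zero * v j                       ≡⟨ cong (_* v j) (trans (*-comm _ _) c₀a≡1) ⟩
          1# * v j                               ≡⟨ *-identityˡ _ ⟩
          v j                                    ∎)) v∉

  independent-tail : ∀ {m} {B : Fin (suc m) → V} → LinIndep F B → LinIndep F (B ∘ suc)
  independent-tail {B = B} ind c c≈0 i = ind (0# ∷ c) (λ j → trans (cong₂ _+_ (zeroˡ _) (c≈0 j)) (+-identityʳ 0#)) (suc i)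

  -- Only an irrefutable existence is needed, so membership in a span need not be decided.
  basis : ∀ {m} (D : Fin m → V) → ¬ ¬ (∃ λ m′ → Σ (Fin m′ → V) λ G → LinIndep F G × G ⊑ D × D ⊑ G)
  basis {zero}  D k = k (0 , D , (λ _ _ ()) , (λ ()) , (λ ()))
  basis {suc m} D k = basis (D ∘ suc) λ { (m′ , G , ind , G⊑D′ , D′⊑G) →
    let v∉G : ¬ (D zero ∈⟨ G ⟩)
        v∉G v∈ = k (m′ , G , ind , (λ i → ∈-weaken D (G⊑D′ i)) , λ { zero → v∈ ; (suc i) → D′⊑G i })
    in k (suc m′ , (D zero ∷ G) , independent-∷ {G = G} ind v∉G
         , (λ { zero → ∈-member D zero ; (suc i) → ∈-weaken D (G⊑D′ i) })
         , (λ { zero → ∈-member (D zero ∷ G) zero ; (suc i) → ∈-weaken (D zero ∷ G) (D′⊑G i) })) }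

-- The features common to the three kinds of forms: a reflexive σ-sesquilinear form β, linear in its first argument, and the
-- set of its singular vectors: the zeros of the quadratic form, or the v with β v v ≡ 0# (all v in the symplectic case).
module _ {q : ℕ} (F : FiniteField q) (n : ℕ) where
  open SpanTheory F n

  record Polarity : Set₁ where
    field
      σ         : Carrier → Carrier
      σ-+       : ∀ x y → σ (x + y) ≡ σ x + σ y
      σ-*       : ∀ x y → σ (x * y) ≡ σ x * σ y
      σ-σ       : ∀ x → σ (σ x) ≡ x
      ε         : Carrier
      ε*ε≡1     : ε * ε ≡ 1#
      σ-ε       : σ ε ≡ ε
      β         : V → V → Carrier
      β-cong    : ∀ {x x′ y y′} → x ≈ x′ → y ≈ y′ → β x y ≡ β x′ y′
      β-⊞ˡ      : ∀ x y z → β (x ⊞ y) z ≡ β x z + β y z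
      β-·ˡ      : ∀ a x z → β (a · x) z ≡ a * β x z
      β-sym     : ∀ x y → β y x ≡ ε * σ (β x y)
      Sing      : V → Set
      Sing-cong : ∀ {x y} → x ≈ y → Sing x → Sing y
      Sing-0    : Sing 0V
      Sing-·    : ∀ a {x} → Sing x → Sing (a · x)
      -- For quadratic forms a - τ(a) is 0, so this says orthogonality, also in characteristic 2.
      -- For Hermitian forms it is an element of trace zero.
      Sing-⊞    : ∀ {x y} a → Sing x → Sing y → β x y ≡ a + - (ε * σ a) → Sing (x ⊞ y)
      Sing-β    : ∀ {x} → Sing x → β x x ≡ 0#
      adjust    : ∀ {e f} → Sing e → β e f ≡ 1# → ∃ λ c → Sing (f ⊞ c · e)
      -- Restricted to singular x, since in characteristic 2 the polar form of a non-degenerate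
      -- quadratic form can have a radical with nonsingular vectors.
      nondegenerate : ∀ {x} → Sing x → (∀ y → β x y ≡ 0#) → x ≈ 0V

    TI : ∀ {m} → (Fin m → V) → Set
    TI B = (∀ i → Sing (B i)) × (∀ i j → β (B i) (B j) ≡ 0#)

-- Totally isotropic spaces and hyperbolic systems.

module PolarTheory {q : ℕ} (F : FiniteField q) {n : ℕ} (pol : Polarity F n) where
  open SpanTheory F n public
  open Polarity pol public
  open ≡-Reasoning
  open Conjugation σ σ-+ σ-* σ-σ ε ε*ε≡1 σ-ε

  ⊥-sym : ∀ {x y} → β x y ≡ 0# → β y x ≡ 0#
  ⊥-sym {x} {y} eq = trans (β-sym x y) (trans (cong τ eq) τ-0)

  β-0ˡ : ∀ y → β 0V y ≡ 0#
  β-0ˡ y = trans (β-cong {0V} {0# · 0V} (λ j → sym (zeroˡ 0#)) (λ _ → refl)) (trans (β-·ˡ 0# 0V y) (zeroˡ _))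

  β-lin : ∀ {m} (B : Fin m → V) c y → β (lin B c) y ≡ Σ′ (λ i → c i * β (B i) y)
  β-lin {zero}  B c y = β-0ˡ y
  β-lin {suc m} B c y = trans (β-⊞ˡ (c zero · B zero) (lin (B ∘ suc) (c ∘ suc)) y)
    (cong₂ _+_ (β-·ˡ (c zero) (B zero) y) (β-lin (B ∘ suc) (c ∘ suc) y))

  β-⊞ʳ : ∀ x y z → β x (y ⊞ z) ≡ β x y + β x z
  β-⊞ʳ x y z = begin
    β x (y ⊞ z)               ≡⟨ β-sym (y ⊞ z) x ⟩
    τ (β (y ⊞ z) x)           ≡⟨ cong τ (β-⊞ˡ y z x) ⟩
    τ (β y x + β z x)         ≡⟨ τ-+ _ _ ⟩
    τ (β y x) + τ (β z x)     ≡⟨ sym (cong₂ _+_ (β-sym y x) (β-sym z x)) ⟩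
    β x y + β x z             ∎

  -- Scalars in the second argument are written as σ(a), so that they leave β as a. This is the
  -- reason for `σ ∘ c` in `β-linʳ` and for `σ ∘ T A i` in `graph`.
  β-·ʳ : ∀ x a y → β x (σ a · y) ≡ a * β x y
  β-·ʳ x a y = begin
    β x (σ a · y)         ≡⟨ β-sym (σ a · y) x ⟩
    τ (β (σ a · y) x)     ≡⟨ cong τ (β-·ˡ (σ a) y x) ⟩
    τ (σ a * β y x)       ≡⟨ τ-*σ (σ a) (β y x) ⟩
    σ (σ a) * τ (β y x)   ≡⟨ cong₂ _*_ (σ-σ a) (sym (β-sym y x)) ⟩
    a * β x y             ∎

  β-linʳ : ∀ {m} (B : Fin m → V) c x → β x (lin B (σ ∘ c)) ≡ Σ′ (λ i → c i * β x (B i))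
  β-linʳ {zero}  B c x = ⊥-sym (β-0ˡ x)
  β-linʳ {suc m} B c x = trans (β-⊞ʳ x (σ (c zero) · B zero) (lin (B ∘ suc) (σ ∘ c ∘ suc)))
    (cong₂ _+_ (β-·ʳ x (c zero) (B zero)) (β-linʳ (B ∘ suc) (c ∘ suc) x))

  lin-⊥ : ∀ {m} {B : Fin m → V} {y} → (∀ i → β (B i) y ≡ 0#) → ∀ c → β (lin B c) y ≡ 0#
  lin-⊥ {B = B} {y} B⊥y c = trans (β-lin B c y) (∑-zero (λ i → trans (cong (c i *_) (B⊥y i)) (zeroʳ _)))

  TI-⊥ : ∀ {m} {B : Fin m → V} → TI B → ∀ c d → β (lin B c) (lin B d) ≡ 0#
  TI-⊥ (_ , B⊥B) c d = lin-⊥ (λ i → ⊥-sym (lin-⊥ (λ j → B⊥B j i) d)) c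

  TI-Sing : ∀ {m} {B : Fin m → V} → TI B → ∀ c → Sing (lin B c)
  TI-Sing {zero}  _ c = Sing-0
  TI-Sing {suc m} {B} (sing , B⊥B) c = Sing-⊞ 0# (Sing-· (c zero) (sing zero)) (TI-Sing {B = B ∘ suc} (sing ∘ suc , λ i j → B⊥B (suc i) (suc j)) (c ∘ suc))
    (trans (trans (β-·ˡ (c zero) (B zero) _)
      (trans (cong (c zero *_) (⊥-sym (lin-⊥ (λ i → B⊥B (suc i) zero) (c ∘ suc)))) (zeroʳ _)))
     (sym (trans (cong (λ z → 0# + - z) τ-0) (-‿inverseʳ 0#))))

  TI-⊑ : ∀ {m m′} {B : Fin m → V} {D : Fin m′ → V} → TI D → B ⊑ D → TI B
  TI-⊑ tiD B⊑D =
    (λ i → Sing-cong (λ j → sym (proj₂ (B⊑D i) j)) (TI-Sing tiD (proj₁ (B⊑D i)))) ,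
    (λ i j → trans (β-cong (proj₂ (B⊑D i)) (proj₂ (B⊑D j))) (TI-⊥ tiD (proj₁ (B⊑D i)) (proj₁ (B⊑D j))))

  β-coordinates : ∀ {x} → (∀ i → β x (δ i) ≡ 0#) → ∀ y → β x y ≡ 0#
  β-coordinates {x} x⊥δ y = trans (β-cong {y = y} (λ _ → refl) expand)
    (⊥-sym (lin-⊥ (λ i → ⊥-sym (x⊥δ i)) y))
    where
    expand : y ≈ lin δ y
    expand j = sym (∑-δʳ j y)

  -- Gram-Schmidt against a dual system `f` of the tail. The vector u₀′ = u₀ - Σ β(u₀,f_j) u_(j+1)
  -- is not in the radical, so some coordinate vector w is not orthogonal to it. Subtracting the
  -- f-components of w gives a v that is orthogonal to the tail and satisfies β(u₀,v) = β(u₀′,w);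
  -- rescaled, it is the new dual vector, and multiples of it correct the old ones.
  dual-basis : ∀ {m} (u : Fin m → V) → (∀ c → (∀ y → β (lin u c) y ≡ 0#) → ∀ i → c i ≡ 0#) →
    Σ (Fin m → V) λ f → ∀ i j → β (u i) (f j) ≡ δ i j
  dual-basis {zero}  u _  = u , λ ()
  dual-basis {suc m} u nd with dual-basis (u ∘ suc) (λ c c⊥ i → nd (0# ∷ c) (λ y →
      trans (β-⊞ˡ (0# · u zero) (lin (u ∘ suc) c) y)
        (trans (cong₂ _+_ (trans (β-·ˡ 0# (u zero) y) (zeroˡ _)) (c⊥ y)) (+-identityʳ 0#))) (suc i))
  ... | f , uf≡δ with Fin.¬∀⟶∃¬ n _ (λ i → β u₀′ (δ i) ≟ 0#) (λ u₀′⊥ → 0≢1 (sym (nd c (β-coordinates u₀′⊥) zero)))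
    where
    c : Fin (suc m) → Carrier
    c = 1# ∷ λ j → - β (u zero) (f j)
    u₀′ = lin u c
  ... | l , κ≢0 with inverse _ κ≢0
  ... | a , κa≡1 = (g ∷ f′) , λ
          { zero zero → trans u₀g (sym (δ-refl {suc m} zero))
          ; zero (suc j) → begin
              β (u zero) (f j ⊞ σ (- β (u zero) (f j)) · g)     ≡⟨ β-⊞ʳ _ _ _ ⟩
              β (u zero) (f j) + β (u zero) (σ (- β (u zero) (f j)) · g)   ≡⟨ cong (β (u zero) (f j) +_) (β-·ʳ (u zero) _ g) ⟩
              β (u zero) (f j) + - β (u zero) (f j) * β (u zero) g         ≡⟨ cong (λ z → β (u zero) (f j) + - β (u zero) (f j) * z) u₀g ⟩
              β (u zero) (f j) + - β (u zero) (f j) * 1#        ≡⟨ cong (β (u zero) (f j) +_) (*-identityʳ _) ⟩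
              β (u zero) (f j) + - β (u zero) (f j)             ≡⟨ -‿inverseʳ _ ⟩
              0#                                                ≡⟨ sym (δ-≢ {i = zero} {suc j} λ ()) ⟩
              δ zero (suc j)                                    ∎
          ; (suc i) zero → trans (ug i) (sym (δ-≢ {i = suc i} {zero} λ ()))
          ; (suc i) (suc j) → begin
              β (u (suc i)) (f j ⊞ σ (- β (u zero) (f j)) · g)  ≡⟨ β-⊞ʳ _ _ _ ⟩
              β (u (suc i)) (f j) + β (u (suc i)) (σ (- β (u zero) (f j)) · g)  ≡⟨ cong₂ _+_ (uf≡δ i j) (trans (β-·ʳ (u (suc i)) _ g) (trans (cong (- β (u zero) (f j) *_) (ug i)) (zeroʳ _))) ⟩
              δ i j + 0#                                        ≡⟨ +-identityʳ _ ⟩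
              δ i j                                             ≡⟨ δ-suc i j ⟩
              δ (suc i) (suc j)                                 ∎ }
    where
    w : V
    w = δ l
    v = w ⊞ lin f (σ ∘ λ j → - β (u (suc j)) w)
    g = σ a · v
    f′ : Fin m → V
    f′ j = f j ⊞ σ (- β (u zero) (f j)) · g
    δ-suc : ∀ {m} (i j : Fin m) → δ i j ≡ δ (suc i) (suc j)
    δ-suc i j with i Fin.≟ j
    ... | yes refl = refl
    ... | no  i≢j  = refl
    βv : ∀ x → β x v ≡ β x w + Σ′ (λ j → - β (u (suc j)) w * β x (f j))
    βv x = trans (β-⊞ʳ x w _) (cong (β x w +_) (β-linʳ f _ x))
    uv : ∀ i → β (u (suc i)) v ≡ 0#
    uv i = begin
      β (u (suc i)) v                                            ≡⟨ βv (u (suc i)) ⟩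
      β (u (suc i)) w + Σ′ (λ j → - β (u (suc j)) w * β (u (suc i)) (f j))  ≡⟨ cong (β (u (suc i)) w +_) (trans (∑-cong {m} (λ j → cong (- β (u (suc j)) w *_) (trans (uf≡δ i j) (δ-sym i j)))) (∑-δʳ i (λ j → - β (u (suc j)) w))) ⟩
      β (u (suc i)) w + - β (u (suc i)) w                        ≡⟨ -‿inverseʳ _ ⟩
      0#                                                         ∎
    u₀v : β (u zero) v ≡ β (lin u (1# ∷ λ j → - β (u zero) (f j))) w
    u₀v = begin
      β (u zero) v                                               ≡⟨ βv (u zero) ⟩
      β (u zero) w + Σ′ (λ j → - β (u (suc j)) w * β (u zero) (f j))     ≡⟨ cong₂ _+_ (sym (*-identityˡ _)) (∑-cong {m} (λ j →
         trans (sym (-‿distribˡ-* _ _)) (trans (cong -_ (*-comm _ _)) (-‿distribˡ-* _ _)))) ⟩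
      1# * β (u zero) w + Σ′ (λ j → - β (u zero) (f j) * β (u (suc j)) w) ≡⟨ sym (β-lin u (1# ∷ λ j → - β (u zero) (f j)) w) ⟩
      β (lin u (1# ∷ λ j → - β (u zero) (f j))) w                ∎
    u₀g : β (u zero) g ≡ 1#
    u₀g = trans (β-·ʳ (u zero) a v) (trans (*-comm a _) (trans (cong (_* a) u₀v) κa≡1))
    ug : ∀ i → β (u (suc i)) g ≡ 0#
    ug i = trans (β-·ʳ (u (suc i)) a v) (trans (cong (a *_) (uv i)) (zeroʳ a))

  -- f j is first made singular by a multiple of e j; subtracting β (f j) (f k) · e k for k > j then makes f totally isotropic.
  hyperbolic : ∀ {m} {e : Fin m → V} → LinIndep F e → TI e →
    Σ (Fin m → V) λ f → (∀ i j → β (e i) (f j) ≡ δ i j) × TI f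
  hyperbolic {m} {e} ind ti@(sing-e , e⊥e)
    with dual-basis e (λ c c⊥ → ind c (nondegenerate (TI-Sing ti c) c⊥))
  ... | f₀ , ef₀≡δ = f , ef≡δ , sing-f , f⊥f
    where
    adjusted : ∀ j → ∃ λ c → Sing (f₀ j ⊞ c · e j)
    adjusted j = adjust (sing-e j) (trans (ef₀≡δ j j) (δ-refl j))

    f₁ : Fin m → V
    f₁ j = f₀ j ⊞ proj₁ (adjusted j) · e j

    ef₁≡δ : ∀ i j → β (e i) (f₁ j) ≡ δ i j
    ef₁≡δ i j = trans (β-⊞ʳ _ _ _) (trans (cong₂ _+_ (ef₀≡δ i j)
      (⊥-sym (trans (β-·ˡ _ _ _) (trans (cong (proj₁ (adjusted j) *_) (e⊥e j i)) (zeroʳ _))))) (+-identityʳ _))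

    c : Fin m → Fin m → Carrier
    c j k with Fin.<-cmp j k
    ... | tri< _ _ _ = - β (f₁ j) (f₁ k)
    ... | tri≈ _ _ _ = 0#
    ... | tri> _ _ _ = 0#

    c-diagonal : ∀ j → c j j ≡ 0#
    c-diagonal j with Fin.<-cmp j j
    ... | tri< j<j _ _ = contradiction j<j (Fin.<-irrefl refl)
    ... | tri≈ _ _ _   = refl
    ... | tri> _ _ _   = refl

    f : Fin m → V
    f j = f₁ j ⊞ lin e (c j)

    β-e-f₁ : ∀ (d : Fin m → Carrier) j → β (lin e d) (f₁ j) ≡ d j
    β-e-f₁ d j = trans (β-lin e d (f₁ j)) (trans (∑-cong (λ i → cong (d i *_) (ef₁≡δ i j))) (∑-δʳ j d))

    ef≡δ : ∀ i j → β (e i) (f j) ≡ δ i j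
    ef≡δ i j = trans (β-⊞ʳ _ _ _) (trans (cong₂ _+_ (ef₁≡δ i j) (⊥-sym (lin-⊥ (λ l → e⊥e l i) (c j)))) (+-identityʳ _))

    sing-f : ∀ j → Sing (f j)
    sing-f j = Sing-⊞ 0# (proj₂ (adjusted j)) (TI-Sing ti (c j))
      (trans (trans (β-sym (lin e (c j)) (f₁ j)) (trans (cong τ (trans (β-e-f₁ (c j) j) (c-diagonal j))) τ-0))
             (sym (trans (cong (λ z → 0# + - z) τ-0) (-‿inverseʳ 0#))))

    balance : ∀ j k → β (f₁ j) (f₁ k) + c j k + τ (c k j) ≡ 0#
    balance j k with Fin.<-cmp j k | Fin.<-cmp k j
    ... | tri< _ _ _    | tri> _ _ _ = trans (cong₂ _+_ (-‿inverseʳ _) τ-0) (+-identityʳ 0#)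
    ... | tri< j<k _ _  | tri< _ _ j≮k = contradiction j<k j≮k
    ... | tri< j<k _ _  | tri≈ _ _ j≮k = contradiction j<k j≮k
    ... | tri≈ _ refl _ | tri≈ _ _ _ = trans (cong₂ _+_ (trans (+-identityʳ _) (Sing-β (proj₂ (adjusted j)))) τ-0) (+-identityʳ 0#)
    ... | tri≈ _ refl _ | tri< j<j _ _ = contradiction j<j (Fin.<-irrefl refl)
    ... | tri≈ _ refl _ | tri> _ _ j<j = contradiction j<j (Fin.<-irrefl refl)
    ... | tri> _ _ k<j  | tri≈ k≮j _ _ = contradiction k<j k≮j
    ... | tri> _ _ k<j  | tri> k≮j _ _ = contradiction k<j k≮j
    ... | tri> _ _ _    | tri< _ _ _ = begin
      β (f₁ j) (f₁ k) + 0# + τ (- β (f₁ k) (f₁ j))   ≡⟨ cong₂ _+_ (+-identityʳ _) (τ-neg _) ⟩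
      β (f₁ j) (f₁ k) + - τ (β (f₁ k) (f₁ j))        ≡⟨ cong (λ z → β (f₁ j) (f₁ k) + - z) (sym (β-sym (f₁ k) (f₁ j))) ⟩
      β (f₁ j) (f₁ k) + - β (f₁ j) (f₁ k)            ≡⟨ -‿inverseʳ _ ⟩
      0#                                             ∎

    f⊥f : ∀ j k → β (f j) (f k) ≡ 0#
    f⊥f j k = begin
      β (f j) (f k)                                                      ≡⟨ β-⊞ʳ (f j) (f₁ k) (lin e (c k)) ⟩
      β (f j) (f₁ k) + β (f j) (lin e (c k))                             ≡⟨ cong₂ _+_ (β-⊞ˡ (f₁ j) _ (f₁ k)) (β-⊞ˡ (f₁ j) _ (lin e (c k))) ⟩
      β (f₁ j) (f₁ k) + β (lin e (c j)) (f₁ k) + (β (f₁ j) (lin e (c k)) + β (lin e (c j)) (lin e (c k)))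
        ≡⟨ cong₂ _+_ (cong (β (f₁ j) (f₁ k) +_) (β-e-f₁ (c j) k))
                     (trans (cong₂ _+_ (trans (β-sym (lin e (c k)) (f₁ j)) (cong τ (β-e-f₁ (c k) j))) (TI-⊥ ti (c j) (c k))) (+-identityʳ _)) ⟩
      β (f₁ j) (f₁ k) + c j k + τ (c k j)                                ≡⟨ balance j k ⟩
      0#                                                                 ∎

  IsTISpace : ∀ {m} → (Fin m → V) → Set
  IsTISpace B = LinIndep F B × TI B

  record Describes (P : Form F n) : Set where
    field
      totIso⇒TI : ∀ {m} {B : Fin m → V} → TotIso F P B → TI B
      TI⇒totIso : ∀ {m} {B : Fin m → V} → TI B → TotIso F P B

  -- Extension of totally isotropic spaces to generators.

  module Generators {P : Form F n} (describes : Describes P) {r : ℕ}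
    (noBig : ∀ (B : Fin (suc r) → V) → ¬ IsSpace F P (suc r) B) where
    open Describes describes

    -- `noBig` speaks of dimension r + 1 only; a longer basis is cut down to that length by dropping
    -- its first vectors.
    space-≤ : ∀ {m} {B : Fin m → V} → IsTISpace B → m ℕ.≤ r
    space-≤ {m} {B} sp = ℕ.≮⇒≥ λ r<m → go (ℕ.≤⇒≤′ r<m) sp
      where
      go : ∀ {m} → suc r ℕ.≤′ m → {B : Fin m → V} → ¬ IsTISpace B
      go ℕ.≤′-refl         {B} (ind , ti) = noBig B (ind , TI⇒totIso ti)
      go (ℕ.≤′-step r<m) {B} (ind , sing , B⊥B) = go r<m (independent-tail {B = B} ind , sing ∘ suc , λ i j → B⊥B (suc i) (suc j))

    rank-space-generator : ∀ {G : Fin r → V} → IsTISpace G → IsGenerator F P r G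
    rank-space-generator {G} (ind , ti) = (ind , TI⇒totIso ti) , λ C sp _ → noBig C sp

    -- Maximality is not decided. If no generator contained `G`, then `G` itself would be one: any
    -- space one dimension larger that contains `G` lies in a generator by induction. The fuel
    -- bounds the number of dimensions still missing up to `r`.
    extend : ∀ fuel {m} {G : Fin m → V} → r ℕ.≤ m ℕ.+ fuel → IsTISpace G → ¬ ¬ (∃ λ m′ → Σ (Fin m′ → V) λ G′ → IsGenerator F P m′ G′ × G ⊑ G′)
    extend fuel {m} {G} r≤ (ind , ti) k = k (m , G , ((ind , TI⇒totIso ti) , larger fuel r≤) , ⊑-refl)
      where
      larger : ∀ fuel → r ℕ.≤ m ℕ.+ fuel → (C : Fin (suc m) → V) → IsSpace F P (suc m) C → ¬ (G ⊑ C)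
      larger zero     r≤ C (indC , tiC) G⊑C =
        ℕ.<⇒≱ (space-≤ (indC , totIso⇒TI tiC)) (ℕ.≤-trans r≤ (ℕ.≤-reflexive (ℕ.+-identityʳ m)))
      larger (suc fuel) r≤ C (indC , tiC) G⊑C =
        extend fuel (ℕ.≤-trans r≤ (ℕ.≤-reflexive (ℕ.+-suc m fuel))) (indC , totIso⇒TI tiC)
          λ { (m′ , G′ , gen , C⊑G′) → k (m′ , G′ , gen , ⊑-trans {B = G} {C} {G′} G⊑C C⊑G′) }

    common-generator : ∀ {k k′} {B : Fin k → V} {B′ : Fin k′ → V} → TI B → TI B′ → (∀ i j → β (B i) (B′ j) ≡ 0#) →
      ¬ ¬ (∃ λ m → Σ (Fin m → V) λ G → IsGenerator F P m G × B ⊑ G × B′ ⊑ G)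
    common-generator {k} {k′} {B} {B′} (sing , B⊥B) (sing′ , B′⊥B′) B⊥B′ none =
      basis D λ { (m , G , ind , G⊑D , D⊑G) →
        extend r (ℕ.m≤n+m r m) (ind , TI-⊑ {B = G} {D} tiD G⊑D)
          λ { (m′ , G′ , gen , G⊑G′) → none (m′ , G′ , gen
            , (λ i → subst (_∈⟨ G′ ⟩) (cong [ B , B′ ]′ (Fin.splitAt-↑ˡ k i k′)) (⊑-trans {B = D} {G} {G′} D⊑G G⊑G′ (i Fin.↑ˡ k′)))
            , (λ i → subst (_∈⟨ G′ ⟩) (cong [ B , B′ ]′ (Fin.splitAt-↑ʳ k k′ i)) (⊑-trans {B = D} {G} {G′} D⊑G G⊑G′ (k Fin.↑ʳ i)))) } }
      where
      D : Fin (k ℕ.+ k′) → V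
      D = [ B , B′ ]′ ∘ splitAt k
      sing-D : ∀ (s : Fin k ⊎ Fin k′) → Sing ([ B , B′ ]′ s)
      sing-D (inj₁ i) = sing i
      sing-D (inj₂ i) = sing′ i
      D⊥D : ∀ (s t : Fin k ⊎ Fin k′) → β ([ B , B′ ]′ s) ([ B , B′ ]′ t) ≡ 0#
      D⊥D (inj₁ i) (inj₁ j) = B⊥B i j
      D⊥D (inj₁ i) (inj₂ j) = B⊥B′ i j
      D⊥D (inj₂ i) (inj₁ j) = ⊥-sym (B⊥B′ j i)
      D⊥D (inj₂ i) (inj₂ j) = B′⊥B′ i j
      tiD : TI D
      tiD = (λ i → sing-D (splitAt k i)) , λ i j → D⊥D (splitAt k i) (splitAt k j)

  -- Graphs of skew matrices and the number of distinct members of the family.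

  module Counting {P : Form F n} (describes : Describes P)
    {r : ℕ} (noBig : ∀ (B : Fin (suc r) → V) → ¬ IsSpace F P (suc r) B)
    (e f : Fin r → V) (ti-e : TI e) (ti-f : TI f) (ef≡δ : ∀ i j → β (e i) (f j) ≡ δ i j) where
    open Describes describes
    open Generators describes noBig

    Matrix : Set
    Matrix = Fin r → Fin r → Carrier

    -- T A i j ≡ - τ (T A j i) makes the graph totally isotropic. In the quadratic case T A is even alternating, which in
    -- characteristic 2 would not follow from this equation.
    T : Matrix → Matrix
    T A i j = A i j + - τ (A j i)

    graph : Matrix → Fin r → V
    graph A i = e i ⊞ lin f (σ ∘ T A i)

    β-e-linf : ∀ i (t : Fin r → Carrier) → β (e i) (lin f (σ ∘ t)) ≡ t i
    β-e-linf i t = trans (β-linʳ f t (e i)) (trans (∑-cong (λ j → cong (t j *_) (trans (ef≡δ i j) (δ-sym i j)))) (∑-δʳ i t))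

    β-linf-e : ∀ i (t : Fin r → Carrier) → β (lin f (σ ∘ t)) (e i) ≡ τ (t i)
    β-linf-e i t = trans (β-sym (e i) _) (cong τ (β-e-linf i t))

    β-graph-f : ∀ A i j → β (graph A i) (f j) ≡ δ i j
    β-graph-f A i j = trans (β-⊞ˡ _ _ _) (trans (cong₂ _+_ (ef≡δ i j) (lin-⊥ (λ l → proj₂ ti-f l j) _)) (+-identityʳ _))

    β-graph-e : ∀ A i j → β (graph A i) (e j) ≡ τ (T A i j)
    β-graph-e A i j = trans (β-⊞ˡ _ _ _) (trans (cong₂ _+_ (proj₂ ti-e i j) (β-linf-e j (T A i))) (+-identityˡ _))

    T-skew : ∀ A i k → T A k i + τ (T A i k) ≡ 0#
    T-skew A i k = begin
      A k i + - τ (A i k) + τ (A i k + - τ (A k i))          ≡⟨ cong (A k i + - τ (A i k) +_) (trans (τ-+ _ _) (cong (τ (A i k) +_) (trans (τ-neg _) (cong -_ (τ-τ _))))) ⟩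
      A k i + - τ (A i k) + (τ (A i k) + - A k i)            ≡⟨ +-assoc _ _ _ ⟩
      A k i + (- τ (A i k) + (τ (A i k) + - A k i))          ≡⟨ cong (A k i +_) (trans (sym (+-assoc _ _ _)) (trans (cong (_+ - A k i) (-‿inverseˡ _)) (+-identityˡ _))) ⟩
      A k i + - A k i                                        ≡⟨ -‿inverseʳ _ ⟩
      0#                                                     ∎

    graph-coefficient : ∀ A c j → β (lin (graph A) c) (f j) ≡ c j
    graph-coefficient A c j = trans (β-lin (graph A) c (f j))
      (trans (∑-cong (λ i → cong (c i *_) (β-graph-f A i j))) (∑-δʳ j c))

    graph-space : ∀ A → IsTISpace (graph A)
    graph-space A = ind , (λ i → Sing-⊞ (A i i) (proj₁ ti-e i) (TI-Sing ti-f _) (β-e-linf i (T A i))) , λ i k → begin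
        β (graph A i) (graph A k)                              ≡⟨ β-⊞ʳ (graph A i) (e k) _ ⟩
        β (graph A i) (e k) + β (graph A i) (lin f (σ ∘ T A k))  ≡⟨ cong₂ _+_ (β-graph-e A i k) (trans (β-⊞ˡ (e i) _ _)
                                                                       (trans (cong₂ _+_ (β-e-linf i (T A k)) (TI-⊥ ti-f _ _)) (+-identityʳ _))) ⟩
        τ (T A i k) + T A k i                                  ≡⟨ trans (+-comm _ _) (T-skew A i k) ⟩
        0#                                                     ∎
      where
      ind : LinIndep F (graph A)
      ind c c≈0 j = trans (sym (graph-coefficient A c j)) (trans (β-cong {y = f j} c≈0 (λ _ → refl)) (β-0ˡ (f j)))

    -- Equations satisfied by the vectors of the graph, where β(x,f_i) is the coefficient of x at
    -- the i-th basis vector. They are stable under double negation, unlike membership in a span as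
    -- it is given here.
    OnGraph : Matrix → V → Set
    OnGraph A x = ∀ j → β x (e j) ≡ Σ′ (λ i → β x (f i) * τ (T A i j))

    ∈graph⇒OnGraph : ∀ {A x} → x ∈⟨ graph A ⟩ → OnGraph A x
    ∈graph⇒OnGraph {A} {x} (c , x≈) j = begin
      β x (e j)                                  ≡⟨ β-cong {y = e j} x≈ (λ _ → refl) ⟩
      β (lin (graph A) c) (e j)                  ≡⟨ β-lin (graph A) c (e j) ⟩
      Σ′ (λ i → c i * β (graph A i) (e j))       ≡⟨ ∑-cong (λ i → cong₂ _*_ (sym (coefficient i)) (β-graph-e A i j)) ⟩
      Σ′ (λ i → β x (f i) * τ (T A i j))         ∎
      where
      coefficient : ∀ i → β x (f i) ≡ c i
      coefficient i = trans (β-cong {y = f i} x≈ (λ _ → refl)) (graph-coefficient A c i)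

    ∈graph-nonzero : ∀ {A x} → x ∈⟨ graph A ⟩ → ¬ (x ≈ 0V) → ∃ λ i → β x (f i) ≢ 0#
    ∈graph-nonzero {A} {x} (c , x≈) x≉0 = Fin.¬∀⟶∃¬ r _ (λ i → β x (f i) ≟ 0#) λ βxf≡0 →
      x≉0 λ j → trans (x≈ j) (lin-0 (graph A) (λ i → trans (sym (graph-coefficient A c i))
        (trans (sym (β-cong {y = f i} x≈ (λ _ → refl))) (βxf≡0 i))) j)

    row : Fin r → (Fin r → Carrier) → Matrix
    row i u l m = δ i l * u m

    row-≢ : ∀ {i l} u m → l ≢ i → row i u l m ≡ 0#
    row-≢ u m l≢i = trans (cong (_* u m) (δ-≢ (l≢i ∘ sym))) (zeroˡ _)

    row-≡ : ∀ i u m → row i u i m ≡ u m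
    row-≡ i u m = trans (cong (_* u m) (δ-refl i)) (*-identityˡ _)

    -- The rows other than i are unaffected by the translation. For j different from i, the j-th
    -- equation of `OnGraph` then determines T_ij, because its coefficient β(x,f_i) is nonzero, and
    -- hence A_ij, because A_ji lies outside row i. The diagonal entry A_ii cannot be obtained in
    -- this way, since T_ii depends on it through a - τ(a) only, so the value of u at i is recorded
    -- separately.
    translate-injective : ∀ {x i} {A A′ : Matrix} {u u′ : Fin r → Carrier} →
      OnGraph A x → OnGraph A′ x → β x (f i) ≢ 0# →
      (∀ l m → A l m + row i u l m ≡ A′ l m + row i u′ l m) → u i ≡ u′ i →
      (∀ l m → A l m ≡ A′ l m) × (∀ m → u m ≡ u′ m)
    translate-injective {x} {i} {A} {A′} {u} {u′} onA onA′ b≢0 eq uᵢ =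
      A≡A′ , λ m → +-cancelˡ (A i m) _ _ (trans (row-eq m) (cong (_+ u′ m) (sym (A≡A′ i m))))
      where
      row-eq : ∀ m → A i m + u m ≡ A′ i m + u′ m
      row-eq m = trans (cong (A i m +_) (sym (row-≡ i u m))) (trans (eq i m) (cong (A′ i m +_) (row-≡ i u′ m)))
      outside : ∀ {l} m → l ≢ i → A l m ≡ A′ l m
      outside {l} m l≢i = trans (sym (+-identityʳ _)) (trans (cong (A l m +_) (sym (row-≢ u m l≢i)))
        (trans (eq l m) (trans (cong (A′ l m +_) (row-≢ u′ m l≢i)) (+-identityʳ _))))
      inside : ∀ {j} → j ≢ i → A i j ≡ A′ i j
      inside {j} j≢i = +-cancelʳ (- τ (A j i)) _ _ (trans
        (τ-injective (*-cancelˡ b≢0 (∑-cancel i (λ l → β x (f l) * τ (T A l j)) (λ l → β x (f l) * τ (T A′ l j))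
          (λ l l≢i → cong₂ (λ a b → β x (f l) * τ (a + - τ b)) (outside j l≢i) (outside l j≢i))
          (trans (sym (onA j)) (onA′ j)))))
        (cong (λ z → A′ i j + - τ z) (sym (outside i j≢i))))
      A≡A′ : ∀ l m → A l m ≡ A′ l m
      A≡A′ l m with l Fin.≟ i | m Fin.≟ i
      ... | no l≢i   | _        = outside m l≢i
      ... | yes refl | no m≢i   = inside m≢i
      ... | yes refl | yes refl = +-cancelʳ (u m) _ _ (trans (row-eq m) (cong (A′ m m +_) (sym uᵢ)))

    -- Only the first argument is expanded over `e` and `f`; each of these 2r vectors gives one
    -- separable term, whatever the vectors y are.
    LowRank-β : ∀ {I J : Set} (A : I → Matrix) (x : I → V) (y : J → V) → (∀ i → x i ∈⟨ graph (A i) ⟩) →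
      LowRank (r ℕ.+ r) (λ i j → β (x i) (y j))
    LowRank-β {I} {J} A x y x∈ = LowRank-cong expand (LowRank-+ {R = r} {R′ = r}
        ((λ l i → coe i l) , (λ l j → β (e l) (y j)) , λ _ _ → refl)
        ((λ l i → Σ′ (λ a → coe i a * σ (T (A i) a l))) , (λ l j → β (f l) (y j)) , λ _ _ → refl))
      where
      coe : I → Fin r → Carrier
      coe i = proj₁ (x∈ i)
      expand : ∀ i j → β (x i) (y j) ≡ Σ′ (λ l → coe i l * β (e l) (y j))
        + Σ′ (λ l → Σ′ (λ a → coe i a * σ (T (A i) a l)) * β (f l) (y j))
      expand i j = begin
        β (x i) (y j)                                ≡⟨ β-cong {y = y j} (proj₂ (x∈ i)) (λ _ → refl) ⟩
        β (lin (graph (A i)) (coe i)) (y j)            ≡⟨ β-lin (graph (A i)) (coe i) (y j) ⟩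
        Σ′ (λ a → coe i a * β (graph (A i) a) (y j))   ≡⟨ ∑-cong (λ a → trans (cong (coe i a *_) (β-⊞ˡ (e a) _ (y j))) (distribˡ _ _ _)) ⟩
        Σ′ (λ a → coe i a * β (e a) (y j) + coe i a * β (lin f (σ ∘ T (A i) a)) (y j))  ≡⟨ ∑-+ {r} _ _ ⟩
        Σ′ (λ a → coe i a * β (e a) (y j)) + Σ′ (λ a → coe i a * β (lin f (σ ∘ T (A i) a)) (y j))
          ≡⟨ cong (Σ′ (λ a → coe i a * β (e a) (y j)) +_) (begin
            Σ′ (λ a → coe i a * β (lin f (σ ∘ T (A i) a)) (y j))  ≡⟨ sym (β-lin (λ a → lin f (σ ∘ T (A i) a)) (coe i) (y j)) ⟩
            β (lin (λ a → lin f (σ ∘ T (A i) a)) (coe i)) (y j)   ≡⟨ β-cong {y = y j} (lin-lin f (λ a → σ ∘ T (A i) a) (coe i)) (λ _ → refl) ⟩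
            β (lin f (λ l → Σ′ (λ a → coe i a * σ (T (A i) a l)))) (y j)  ≡⟨ β-lin f _ (y j) ⟩
            Σ′ (λ l → Σ′ (λ a → coe i a * σ (T (A i) a l)) * β (f l) (y j)) ∎) ⟩
        Σ′ (λ l → coe i l * β (e l) (y j)) + Σ′ (λ l → Σ′ (λ a → coe i a * σ (T (A i) a l)) * β (f l) (y j))  ∎

    module Family {k : ℕ} (O : List (Fin (suc k) → V)) (spaces : All (IsSpace F P (suc k)) O)
      (exact : EveryGeneratorContainsExactlyOne F P O) where

      ⊥⇒⊑ : ∀ {B B′} → B ∈ O → B′ ∈ O → (∀ i j → β (B i) (B′ j) ≡ 0#) → ¬ ¬ (B′ ⊑ B)
      ⊥⇒⊑ {B} {B′} B∈O B′∈O B⊥B′ no⊑ =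
        common-generator (totIso⇒TI (proj₂ (All.lookup spaces B∈O))) (totIso⇒TI (proj₂ (All.lookup spaces B′∈O))) B⊥B′
          λ { (m , G , gen , B⊑G , B′⊑G) →
            let (C , _ , _ , unique) = exact m G gen
            in no⊑ (⊑-trans {B = B′} {C} {B} (proj₁ (unique B′ B′∈O B′⊑G)) (proj₂ (unique B B∈O B⊑G))) }

      N : ℕ
      N = (q ℕ.^ r) ℕ.^ r

      matrix : Fin N → Matrix
      matrix a l = decV {r} (finToFun {q ℕ.^ r} {r} a l)

      matrix-injective : ∀ {a b} → (∀ l m → matrix a l m ≡ matrix b l m) → a ≡ b
      matrix-injective {a} {b} eq = trans (sym (Fin.funToFin-finToFin {r} a))
        (trans (funToFin-cong (λ l → decV-injective {r} (eq l))) (Fin.funToFin-finToFin {r} b))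

      enc : Matrix → Fin N
      enc A = funToFin (λ l → encV (A l))

      enc-injective : ∀ {A A′ : Matrix} → enc A ≡ enc A′ → ∀ l m → A l m ≡ A′ l m
      enc-injective eq l m = encV-injective (funToFin-injective _ _ eq l) m

      private
        chosen : ∀ a → _
        chosen a = exact r (graph (matrix a)) (rank-space-generator (graph-space (matrix a)))

      block : Fin N → Fin (suc k) → V
      block a = proj₁ (chosen a)

      block∈O : ∀ a → block a ∈ O
      block∈O a = proj₁ (proj₂ (chosen a))

      block⊑graph : ∀ a → block a ⊑ graph (matrix a)
      block⊑graph a = proj₁ (proj₂ (proj₂ (chosen a)))

      -- A decidable substitute for equality of the two spaces: equal ones are orthogonal because
      -- they are totally isotropic, and `⊥⇒⊑` gives the converse up to double negation.
      _~_ : Fin N → Fin N → Set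
      a ~ b = ∀ i j → β (block a i) (block b j) ≡ 0#

      classes : Transversal _~_
      classes = transversal _~_ (λ a b → Fin.all? (λ i → Fin.all? (λ j → β (block a i) (block b j) ≟ 0#)))
        (λ a → proj₂ (totIso⇒TI (proj₂ (All.lookup spaces (block∈O a))))) (λ a~b i j → ⊥-sym (a~b j i))

      open Transversal classes

      -- This is where k must be positive: a member needs a nonzero vector.
      point : Fin size → V
      point s = block (member s) zero

      point-nonzero : ∀ s → ¬ (point s ≈ 0V)
      point-nonzero s x≈0 = 0≢1 (trans (sym (independent (δ zero)
          (λ j → trans (lin-δ (block (member s)) zero j) (x≈0 j)) zero)) (δ-refl {suc k} zero))
        where independent = proj₁ (All.lookup spaces (block∈O (member s)))

      pivot : ∀ s → ∃ λ i → β (point s) (f i) ≢ 0#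
      pivot s = ∈graph-nonzero (block⊑graph (member s) zero) (point-nonzero s)

      -- The representative may have been chosen for another matrix, but it is orthogonal to the
      -- block of a, hence contained in it and so in the graph of a.
      on-graph : ∀ a → OnGraph (matrix a) (point (rep a))
      on-graph a j = decidable-stable (_ ≟ _) λ no → ⊥⇒⊑ (block∈O a) (block∈O (member (rep a))) (rep-~ a)
        λ rep⊑ → no (∈graph⇒OnGraph (∈-⊑ {B = block a} {graph (matrix a)} (rep⊑ zero) (block⊑graph a)) j)

      -- The pair (u , a) is recovered from the representative of the block chosen for a, the translate of the matrix of a by u
      -- along the pivot row, and the one coordinate of u that does not change the graph.
      count : q ℕ.^ r ℕ.≤ size ℕ.* q
      count = factor-≤ {{N≢0}} code (λ {ua} {ua′} → code-injective ua ua′)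
        where
        instance
          q≢0 : ℕ.NonZero q
          q≢0 = ℕ.>-nonZero (ℕ.<-trans ℕ.z<s 1<q)
        N≢0 : ℕ.NonZero N
        N≢0 = ℕ.m^n≢0 (q ℕ.^ r) r {{ℕ.m^n≢0 q r}}
        translate : Fin size → (Fin r → Carrier) → Fin N → Fin N
        translate s u a = enc (λ l m → matrix a l m + row (proj₁ (pivot s)) u l m)
        remaining : Fin size → (Fin r → Carrier) → Fin q
        remaining s u = fromC (u (proj₁ (pivot s)))
        code : Fin (q ℕ.^ r) × Fin N → Fin size × Fin N × Fin q
        code (u , a) = rep a , translate (rep a) (decV {r} u) a , remaining (rep a) (decV {r} u)
        -- The pivots depend on the representatives, so these are variables here and their equality
        -- can be matched with `refl`.
        separate : ∀ {s s′ u u′ a a′} → OnGraph (matrix a) (point s) → OnGraph (matrix a′) (point s′) → s ≡ s′ →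
          translate s u a ≡ translate s′ u′ a′ → remaining s u ≡ remaining s′ u′ →
          (∀ l m → matrix a l m ≡ matrix a′ l m) × (∀ m → u m ≡ u′ m)
        separate {s} on on′ refl teq req =
          translate-injective on on′ (proj₂ (pivot s)) (enc-injective teq) (fromC-injective req)
        code-injective : ∀ ua ua′ → code ua ≡ code ua′ → ua ≡ ua′
        code-injective (u , a) (u′ , a′) eq = cong₂ _,_ (decV-injective {r} (proj₂ both)) (matrix-injective (proj₁ both))
          where
          both : (∀ l m → matrix a l m ≡ matrix a′ l m) × (∀ m → decV {r} u m ≡ decV {r} u′ m)
          both = separate {rep a} {rep a′} {u = decV {r} u} {decV {r} u′} {a} {a′} (on-graph a) (on-graph a′)
            (cong proj₁ eq) (cong (proj₁ ∘ proj₂) eq) (cong (proj₂ ∘ proj₂) eq)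

      bound : ∀ p′ h (pr : Prime (suc p′)) .{{_ : ℕ.NonZero p′}} .{{_ : ℕ.NonZero h}} → q ≡ suc p′ ℕ.^ h →
        size ℕ.≤ (suc (((r ℕ.+ r) ℕ.^ p′) ℕ.^ h) ℕ.^ suc k) ℕ.^ suc k
      bound p′ h pr q≡p^h = Indicator.separated-bound p′ h pr q≡p^h
        (λ a b s t → β (block (member s) a) (block (member t) b))
        (λ a b → LowRank-β (matrix ∘ member) (λ s → block (member s) a) (λ t → block (member t) b) (λ s → block⊑graph (member s) a))
        (λ s → proj₂ (totIso⇒TI (proj₂ (All.lookup spaces (block∈O (member s))))))
        (λ s≢t → separated s≢t)

-- Quadratic, symplectic and Hermitian forms as polarities.

module Forms {q : ℕ} (F : FiniteField q) (n : ℕ) where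
  open SpanTheory F n
  open ≡-Reasoning

  Gram : Set
  Gram = Fin n → Fin n → Carrier

  ∑∑-cong : ∀ {f g : Fin n → Fin n → Carrier} → (∀ i j → f i j ≡ g i j) → Σ′ (λ i → Σ′ (f i)) ≡ Σ′ (λ i → Σ′ (g i))
  ∑∑-cong f≗g = ∑-cong (λ i → ∑-cong (f≗g i))

  ∑∑-hom : (φ : Carrier → Carrier) → φ 0# ≡ 0# → (∀ x y → φ (x + y) ≡ φ x + φ y) →
    ∀ (f : Fin n → Fin n → Carrier) → φ (Σ′ (λ i → Σ′ (f i))) ≡ Σ′ (λ i → Σ′ (λ j → φ (f i j)))
  ∑∑-hom φ φ0 φ+ f = trans (∑-hom φ φ0 φ+ {n} _) (∑-cong {n} (λ i → ∑-hom φ φ0 φ+ (f i)))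

  module _ (σ : Carrier → Carrier) (M : Gram) where

    sesq-cong : ∀ {x x′ y y′} → x ≈ x′ → y ≈ y′ → sesq F σ M x y ≡ sesq F σ M x′ y′
    sesq-cong x≈ y≈ = ∑∑-cong (λ i j → cong₂ (λ a b → a * M i j * σ b) (x≈ i) (y≈ j))

    sesq-⊞ˡ : ∀ x y z → sesq F σ M (x ⊞ y) z ≡ sesq F σ M x z + sesq F σ M y z
    sesq-⊞ˡ x y z = trans (∑-cong {n} (λ i → trans
        (∑-cong {n} (λ j → trans (cong (_* σ (z j)) (distribʳ (M i j) (x i) (y i))) (distribʳ _ _ _)))
        (∑-+ {n} _ _))) (∑-+ {n} _ _)

    sesq-·ˡ : ∀ a x z → sesq F σ M (a · x) z ≡ a * sesq F σ M x z
    sesq-·ˡ a x z = sym (trans (∑∑-hom (a *_) (zeroʳ a) (distribˡ a) _)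
      (∑∑-cong (λ i j → trans (sym (*-assoc _ _ _)) (cong (_* σ (z j)) (sym (*-assoc _ _ _))))))

  *-reverse : ∀ a b c → a * b * c ≡ c * b * a
  *-reverse a b c = trans (*-comm _ c) (trans (cong (c *_) (*-comm a b)) (sym (*-assoc _ _ _)))

  bilinear-flip : ∀ a x y → sesq F id a x y ≡ sesq F id (flip a) y x
  bilinear-flip a x y = trans (∑-swap {n} {n} _) (∑∑-cong (λ j i → *-reverse (x i) (a i j) (y j)))

  module Sesquilinear (σ : Carrier → Carrier) (σ-+ : ∀ x y → σ (x + y) ≡ σ x + σ y) (σ-* : ∀ x y → σ (x * y) ≡ σ x * σ y)
    (σ-σ : ∀ x → σ (σ x) ≡ x) (ε : Carrier) (ε*ε≡1 : ε * ε ≡ 1#) (σ-ε : σ ε ≡ ε)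
    (M : Gram) (M-sym : ∀ i j → M j i ≡ ε * σ (M i j)) where

    β : V → V → Carrier
    β = sesq F σ M

    open Conjugation σ σ-+ σ-* σ-σ ε ε*ε≡1 σ-ε public using (τ; τ-+; τ-0; τ-neg; τ-τ)

    β-sym : ∀ x y → β y x ≡ τ (β x y)
    β-sym x y = sym (begin
      τ (β x y)                                                    ≡⟨ ∑∑-hom τ τ-0 τ-+ _ ⟩
      Σ′ (λ i → Σ′ (λ j → τ (x i * M i j * σ (y j))))               ≡⟨ ∑∑-cong (λ i j → term (x i) (M i j) (y j) (M-sym i j)) ⟩
      Σ′ (λ i → Σ′ (λ j → y j * M j i * σ (x i)))                   ≡⟨ ∑-swap {n} {n} _ ⟩
      β y x                                                        ∎)
      where
      term : ∀ a b c {b′} → b′ ≡ τ b → τ (a * b * σ c) ≡ c * b′ * σ a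
      term a b c {b′} b′≡ = begin
        ε * σ (a * b * σ c)         ≡⟨ cong (ε *_) (trans (σ-* _ _) (cong₂ _*_ (σ-* a b) (σ-σ c))) ⟩
        ε * (σ a * σ b * c)         ≡⟨ cong (ε *_) (trans (*-reverse (σ a) (σ b) c) (cong (_* σ a) (*-comm c (σ b)))) ⟩
        ε * (σ b * c * σ a)         ≡⟨ trans (sym (*-assoc _ _ _)) (cong (_* σ a) (trans (sym (*-assoc _ _ _)) (*-comm _ c))) ⟩
        c * (ε * σ b) * σ a         ≡⟨ cong (λ z → c * z * σ a) (sym b′≡) ⟩
        c * b′ * σ a                ∎

    β-square : ∀ x y → β (x ⊞ y) (x ⊞ y) ≡ β x x + β y y + (β x y + β y x)
    β-square x y = begin
      β (x ⊞ y) (x ⊞ y)                          ≡⟨ sesq-⊞ˡ σ M x y (x ⊞ y) ⟩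
      β x (x ⊞ y) + β y (x ⊞ y)                  ≡⟨ cong₂ _+_ (⊞ʳ x) (⊞ʳ y) ⟩
      β x x + β x y + (β y x + β y y)            ≡⟨ cong (β x x + β x y +_) (+-comm _ _) ⟩
      β x x + β x y + (β y y + β y x)            ≡⟨ +-interchange _ _ _ _ ⟩
      β x x + β y y + (β x y + β y x)            ∎
      where
      ⊞ʳ : ∀ z → β z (x ⊞ y) ≡ β z x + β z y
      ⊞ʳ z = trans (β-sym (x ⊞ y) z) (trans (cong τ (sesq-⊞ˡ σ M x y z))
        (trans (τ-+ _ _) (sym (cong₂ _+_ (β-sym x z) (β-sym y z)))))

    β-·-· : ∀ a x → β x x ≡ 0# → β (a · x) (a · x) ≡ 0#
    β-·-· a x xx≡0 = trans (sesq-·ˡ σ M a x (a · x)) (trans (cong (a *_) (trans (β-sym (a · x) x)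
      (trans (cong τ (trans (sesq-·ˡ σ M a x x) (trans (cong (a *_) xx≡0) (zeroʳ a)))) τ-0))) (zeroʳ a))

    -- The first hypothesis serves `adjust`: if β(e,f) = 1 and e is singular, adding c e to f
    -- changes β(f,f) by c + τ(c).
    polarity : (∀ x → ∃ λ c → β x x + (c + τ c) ≡ 0#) → (∀ x → (∀ y → β x y ≡ 0#) → x ≈ 0V) → Polarity F n
    polarity solve nondegenerate = record
      { σ = σ ; σ-+ = σ-+ ; σ-* = σ-* ; σ-σ = σ-σ ; ε = ε ; ε*ε≡1 = ε*ε≡1 ; σ-ε = σ-ε
      ; β = β ; β-cong = sesq-cong σ M ; β-⊞ˡ = sesq-⊞ˡ σ M ; β-·ˡ = sesq-·ˡ σ M ; β-sym = β-sym
      ; Sing = λ x → β x x ≡ 0#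
      ; Sing-cong = λ x≈y → trans (sym (sesq-cong σ M x≈y x≈y))
      ; Sing-0 = trans (sesq-cong σ M 0≈ (λ _ → refl)) (trans (sesq-·ˡ σ M 0# 0V 0V) (zeroˡ _))
      ; Sing-· = λ a {x} → β-·-· a x
      ; Sing-⊞ = λ {x} {y} a xx≡0 yy≡0 xy≡ → begin
          β (x ⊞ y) (x ⊞ y)                          ≡⟨ β-square x y ⟩
          β x x + β y y + (β x y + β y x)            ≡⟨ cong₂ _+_ (trans (cong₂ _+_ xx≡0 yy≡0) (+-identityʳ 0#))
                                                          (cong₂ _+_ xy≡ (trans (β-sym x y) (cong τ xy≡))) ⟩
          0# + (a + - τ a + τ (a + - τ a))           ≡⟨ +-identityˡ _ ⟩
          a + - τ a + τ (a + - τ a)                  ≡⟨ cong (a + - τ a +_) (trans (τ-+ _ _) (trans (cong (τ a +_) (trans (τ-neg _) (cong -_ (τ-τ a)))) (+-comm _ _))) ⟩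
          a + - τ a + (- a + τ a)                    ≡⟨ +-interchange _ _ _ _ ⟩
          a + - a + (- τ a + τ a)                    ≡⟨ trans (cong₂ _+_ (-‿inverseʳ a) (-‿inverseˡ _)) (+-identityʳ 0#) ⟩
          0#                                         ∎
      ; Sing-β = id
      ; adjust = λ {e} {f} ee≡0 ef≡1 → let (c , eq) = solve f in c , (begin
          β (f ⊞ c · e) (f ⊞ c · e)                            ≡⟨ β-square f (c · e) ⟩
          β f f + β (c · e) (c · e) + (β f (c · e) + β (c · e) f)  ≡⟨ cong₂ _+_ (trans (cong (β f f +_) (β-·-· c e ee≡0)) (+-identityʳ _))
                                                                     (trans (+-comm _ _) (cong₂ _+_ (ce-f c ef≡1) (trans (β-sym (c · e) f) (cong τ (ce-f c ef≡1))))) ⟩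
          β f f + (c + τ c)                                    ≡⟨ eq ⟩
          0#                                                   ∎)
      ; nondegenerate = λ {x} _ → nondegenerate x
      }
      where
      0≈ : 0V ≈ 0# · 0V
      0≈ j = sym (zeroˡ 0#)
      ce-f : ∀ {e f} c → β e f ≡ 1# → β (c · e) f ≡ c
      ce-f {e} {f} c ef≡1 = trans (sesq-·ˡ σ M c e f) (trans (cong (c *_) ef≡1) (*-identityʳ c))

  module Quadratic (a : Gram) (polar : IsPolarForm F (quadratic a)) where

    Q : V → Carrier
    Q = quadVal F a

    -- `b` is a bilinear form, in general not symmetric, with Q(x) = b(x,x); no division by 2 is
    -- involved. Its symmetrisation `β` is the polar form of `Q`.
    b β : V → V → Carrier
    b = sesq F id a
    β x y = b x y + b y x

    Q≡b : ∀ x → Q x ≡ b x x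
    Q≡b x = ∑∑-cong (λ i j → cong (_* x j) (*-comm (a i j) (x i)))

    b-⊞ʳ : ∀ x y z → b x (y ⊞ z) ≡ b x y + b x z
    b-⊞ʳ x y z = trans (bilinear-flip a x (y ⊞ z)) (trans (sesq-⊞ˡ id (flip a) y z x)
      (sym (cong₂ _+_ (bilinear-flip a x y) (bilinear-flip a x z))))

    b-·ʳ : ∀ x c y → b x (c · y) ≡ c * b x y
    b-·ʳ x c y = trans (bilinear-flip a x (c · y)) (trans (sesq-·ˡ id (flip a) c y x)
      (cong (c *_) (sym (bilinear-flip a x y))))

    Q-⊞ : ∀ x y → Q (x ⊞ y) ≡ Q x + Q y + β x y
    Q-⊞ x y = begin
      Q (x ⊞ y)                                  ≡⟨ Q≡b (x ⊞ y) ⟩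
      b (x ⊞ y) (x ⊞ y)                          ≡⟨ sesq-⊞ˡ id a x y (x ⊞ y) ⟩
      b x (x ⊞ y) + b y (x ⊞ y)                  ≡⟨ cong₂ _+_ (b-⊞ʳ x x y) (b-⊞ʳ y x y) ⟩
      b x x + b x y + (b y x + b y y)            ≡⟨ cong (b x x + b x y +_) (+-comm _ _) ⟩
      b x x + b x y + (b y y + b y x)            ≡⟨ +-interchange _ _ _ _ ⟩
      b x x + b y y + β x y                      ≡⟨ cong (_+ β x y) (sym (cong₂ _+_ (Q≡b x) (Q≡b y))) ⟩
      Q x + Q y + β x y                          ∎

    Q-· : ∀ c x → Q (c · x) ≡ c * (c * Q x)
    Q-· c x = trans (Q≡b (c · x)) (trans (sesq-·ˡ id a c x (c · x)) (cong (c *_) (trans (b-·ʳ x c x) (cong (c *_) (sym (Q≡b x))))))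

    Q-cong : ∀ {x y} → x ≈ y → Q x ≡ Q y
    Q-cong x≈y = ∑∑-cong (λ i j → cong₂ (λ u v → a i j * u * v) (x≈y i) (x≈y j))

    quadPolar≡β : ∀ x y → quadPolar F a x y ≡ β x y
    quadPolar≡β x y = begin
      Q (x ⊞ y) + - Q x + - Q y                  ≡⟨ cong (λ z → z + - Q x + - Q y) (trans (Q-⊞ x y) (+-assoc _ _ _)) ⟩
      Q x + (Q y + β x y) + - Q x + - Q y        ≡⟨ cong (_+ - Q y) (trans (+-comm _ _) (trans (sym (+-assoc _ _ _)) (trans (cong (_+ (Q y + β x y)) (-‿inverseˡ _)) (+-identityˡ _)))) ⟩
      Q y + β x y + - Q y                        ≡⟨ trans (+-comm _ _) (trans (sym (+-assoc _ _ _)) (trans (cong (_+ β x y) (-‿inverseˡ _)) (+-identityˡ _))) ⟩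
      β x y                                      ∎

    Q-⊞-singular : ∀ {x y} → Q x ≡ 0# → Q y ≡ 0# → Q (x ⊞ y) ≡ β x y
    Q-⊞-singular {x} {y} Qx≡0 Qy≡0 = trans (Q-⊞ x y) (trans (cong (_+ β x y) (trans (cong₂ _+_ Qx≡0 Qy≡0) (+-identityʳ 0#))) (+-identityˡ _))

    Q-·-singular : ∀ c {x} → Q x ≡ 0# → Q (c · x) ≡ 0#
    Q-·-singular c {x} Qx≡0 = trans (Q-· c x) (trans (cong (λ z → c * (c * z)) Qx≡0) (trans (cong (c *_) (zeroʳ c)) (zeroʳ c)))

    polarity : Polarity F n
    polarity = record
      { σ = id ; σ-+ = λ _ _ → refl ; σ-* = λ _ _ → refl ; σ-σ = λ _ → refl
      ; ε = 1# ; ε*ε≡1 = *-identityˡ 1# ; σ-ε = refl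
      ; β = β
      ; β-cong = λ x≈ y≈ → cong₂ _+_ (sesq-cong id a x≈ y≈) (sesq-cong id a y≈ x≈)
      ; β-⊞ˡ = λ x y z → trans (cong₂ _+_ (sesq-⊞ˡ id a x y z) (b-⊞ʳ z x y)) (+-interchange _ _ _ _)
      ; β-·ˡ = λ c x z → trans (cong₂ _+_ (sesq-·ˡ id a c x z) (b-·ʳ z c x)) (sym (distribˡ _ _ _))
      ; β-sym = λ x y → trans (+-comm _ _) (sym (*-identityˡ _))
      ; Sing = λ x → Q x ≡ 0#
      ; Sing-cong = λ x≈y → trans (sym (Q-cong x≈y))
      ; Sing-0 = ∑-zero {n} (λ i → ∑-zero {n} (λ j → zeroʳ _))
      ; Sing-· = Q-·-singular
      ; Sing-⊞ = λ {x} {y} c Qx≡0 Qy≡0 eq → trans (Q-⊞-singular Qx≡0 Qy≡0)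
          (trans eq (trans (cong (λ z → c + - z) (*-identityˡ c)) (-‿inverseʳ c)))
      ; Sing-β = λ {x} Qx≡0 → trans (cong₂ _+_ (trans (sym (Q≡b x)) Qx≡0) (trans (sym (Q≡b x)) Qx≡0)) (+-identityʳ 0#)
      -- As e is singular and β(e,f) = 1, Q(f + c e) = Q(f) + c.
      ; adjust = λ {e} {f} Qe≡0 ef≡1 → - Q f , (begin
          Q (f ⊞ - Q f · e)                                    ≡⟨ Q-⊞ f (- Q f · e) ⟩
          Q f + Q (- Q f · e) + β f (- Q f · e)                ≡⟨ cong₂ _+_ (trans (cong (Q f +_) (Q-·-singular (- Q f) Qe≡0)) (+-identityʳ _))
               (trans (cong₂ _+_ (b-·ʳ f (- Q f) e) (sesq-·ˡ id a (- Q f) e f)) (trans (sym (distribˡ _ _ _))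
                 (trans (cong (- Q f *_) (trans (+-comm _ _) ef≡1)) (*-identityʳ _)))) ⟩
          Q f + - Q f                                          ≡⟨ -‿inverseʳ _ ⟩
          0#                                                   ∎)
      ; nondegenerate = λ {x} Qx≡0 x⊥ → polar x Qx≡0 (λ y → trans (quadPolar≡β x y) (x⊥ y))
      }

    describes : PolarTheory.Describes F polarity (quadratic a)
    describes = record
      { totIso⇒TI = λ {m} {B} tot →
          let sing = λ i → trans (sym (Q-cong (lin-δ B i))) (tot (δ i))
          in sing , λ i j → trans (sym (Q-⊞-singular (sing i) (sing j)))
               (trans (Q-cong (λ l → sym (trans (lin-+ B (δ i) (δ j) l) (cong₂ _+_ (lin-δ B i l) (lin-δ B j l))))) (tot (λ l → δ i l + δ j l)))
      ; TI⇒totIso = PolarTheory.TI-Sing F polarity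
      }

  -- Skew symmetry alone would only give that twice the sum is zero, which says nothing in
  -- characteristic 2. Hence the zero diagonal is used directly: after the first row and column are
  -- split off, their remaining entries cancel in pairs.
  alternating : ∀ {m} (M : Fin m → Fin m → Carrier) → (∀ i → M i i ≡ 0#) → (∀ i j → M j i ≡ - M i j) →
    ∀ (x : Fin m → Carrier) → Σ′ (λ i → Σ′ (λ j → x i * M i j * x j)) ≡ 0#
  alternating {zero}  M _ _ x = refl
  alternating {suc m} M Mii Mij x = begin
    x zero * M zero zero * x zero + Σ′ (λ j → r j) + Σ′ (λ i → x (suc i) * M (suc i) zero * x zero + Σ′ (s i))
      ≡⟨ cong₂ _+_ (trans (cong (_+ Σ′ r) (trans (cong (λ z → x zero * z * x zero) (Mii zero)) (trans (cong (_* x zero) (zeroʳ _)) (zeroˡ _)))) (+-identityˡ _))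
           (trans (∑-+ {m} _ _) (trans (cong (Σ′ (λ i → x (suc i) * M (suc i) zero * x zero) +_)
              (alternating (λ i j → M (suc i) (suc j)) (Mii ∘ suc) (λ i j → Mij (suc i) (suc j)) (x ∘ suc))) (+-identityʳ _))) ⟩
    Σ′ r + Σ′ (λ i → x (suc i) * M (suc i) zero * x zero)      ≡⟨ sym (∑-+ {m} _ _) ⟩
    Σ′ (λ j → r j + x (suc j) * M (suc j) zero * x zero)       ≡⟨ ∑-zero {m} (λ j → trans (cong (r j +_) (begin
      x (suc j) * M (suc j) zero * x zero      ≡⟨ *-reverse _ _ _ ⟩
      x zero * M (suc j) zero * x (suc j)      ≡⟨ cong (λ z → x zero * z * x (suc j)) (Mij zero (suc j)) ⟩
      x zero * - M zero (suc j) * x (suc j)    ≡⟨ trans (cong (_* x (suc j)) (sym (-‿distribʳ-* _ _))) (sym (-‿distribˡ-* _ _)) ⟩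
      - r j                                    ∎)) (-‿inverseʳ _)) ⟩
    0#                                                         ∎
    where
    r : Fin m → Carrier
    r j = x zero * M zero (suc j) * x (suc j)
    s : Fin m → Fin m → Carrier
    s i j = x (suc i) * M (suc i) (suc j) * x (suc j)

  module _ (θ : Involution F) where
    open Involution θ

    -- Some y has nonzero trace. If an x moved by σ has trace zero, then σ(x) = -x differs from x,
    -- so 2 is nonzero, and 2 is the trace of 1. The trace of y is fixed by σ, and so is its
    -- inverse; multiplying y by that inverse normalises the trace to 1.
    trace-unit : ∃ λ z → z + σ z ≡ 1#
    trace-unit = let (y , y+σy≢0) = trace-nonzero
                     (t , yt≡1) = inverse (y + σ y) y+σy≢0
                 in y * t , (begin
      y * t + σ (y * t)        ≡⟨ cong (y * t +_) (trans (σ-* y t) (cong (σ y *_) (fixed y+σy≢0 yt≡1))) ⟩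
      y * t + σ y * t          ≡⟨ sym (distribʳ _ _ _) ⟩
      (y + σ y) * t            ≡⟨ yt≡1 ⟩
      1#                       ∎)
      where
      trace-nonzero : ∃ λ y → y + σ y ≢ 0#
      trace-nonzero with σ-nontrivial
      ... | x , σx≢x with x + σ x ≟ 0#
      ... | no  ≢0 = x , ≢0
      ... | yes x+σx≡0 = 1# , λ 1+σ1≡0 → σx≢x (begin
        σ x                  ≡⟨ -‿uniqueʳ _ _ x+σx≡0 ⟩
        - x                  ≡⟨ sym (-‿uniqueʳ x x (begin
          x + x                ≡⟨ sym (cong₂ _+_ (*-identityˡ x) (*-identityˡ x)) ⟩
          1# * x + 1# * x      ≡⟨ sym (distribʳ _ _ _) ⟩
          (1# + 1#) * x        ≡⟨ cong (_* x) (trans (cong (1# +_) (sym σ-1)) 1+σ1≡0) ⟩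
          0# * x               ≡⟨ zeroˡ x ⟩
          0#                   ∎)) ⟩
        x                    ∎)
      fixed : ∀ {y t} → y + σ y ≢ 0# → (y + σ y) * t ≡ 1# → σ t ≡ t
      fixed {y} {t} y≢0 yt≡1 = *-cancelˡ y≢0 (begin
        (y + σ y) * σ t          ≡⟨ cong (_* σ t) (sym (trans (σ-+ y (σ y)) (trans (cong (σ y +_) (σ-σ y)) (+-comm _ _)))) ⟩
        σ (y + σ y) * σ t        ≡⟨ sym (σ-* _ _) ⟩
        σ ((y + σ y) * t)        ≡⟨ cong σ yt≡1 ⟩
        σ 1#                     ≡⟨ σ-1 ⟩
        1#                       ≡⟨ sym yt≡1 ⟩
        (y + σ y) * t            ∎)

  form-polarity : (P : Form F n) → IsPolarForm F P → Σ (Polarity F n) λ pol → PolarTheory.Describes F pol P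
  form-polarity (quadratic a) polar = Quadratic.polarity a polar , Quadratic.describes a polar
  form-polarity (symplectic M) (Mii , Mij , nondegenerate) = pol , record
    { totIso⇒TI = λ {m} {B} tot →
        (λ i → alternating M Mii Mij (B i)) ,
        (λ i j → trans (sym (S.sesq-cong′ (lin-δ B i) (lin-δ B j))) (tot (δ i) (δ j)))
    ; TI⇒totIso = PolarTheory.TI-⊥ F pol }
    where
    module S where
      open Sesquilinear id (λ _ _ → refl) (λ _ _ → refl) (λ _ → refl) (- 1#)
        (trans (sym (-‿distribˡ-* _ _)) (trans (cong -_ (*-identityˡ _)) (-‿involutive 1#))) refl M
        (λ i j → trans (Mij i j) (trans (cong -_ (sym (*-identityˡ _))) (-‿distribˡ-* _ _))) public
      sesq-cong′ = sesq-cong id M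
    pol = S.polarity (λ x → 0# , trans (cong₂ _+_ (alternating M Mii Mij x) (trans (+-identityˡ _) (zeroʳ _))) (+-identityʳ 0#)) nondegenerate
  form-polarity (hermitian θ M) (Mij , nondegenerate) = pol , record
    { totIso⇒TI = λ {m} {B} tot →
        let ⊥B = λ i j → trans (sym (sesq-cong σ M (lin-δ B i) (lin-δ B j))) (tot (δ i) (δ j))
        in (λ i → ⊥B i i) , ⊥B
    ; TI⇒totIso = PolarTheory.TI-⊥ F pol }
    where
    open Involution θ
    module S = Sesquilinear σ σ-+ σ-* σ-σ 1# (*-identityˡ 1#) σ-1 M (λ i j → trans (Mij i j) (sym (*-identityˡ _)))
    z = proj₁ (trace-unit θ)
    solve : ∀ x → ∃ λ c → S.β x x + (c + S.τ c) ≡ 0#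
    -- D = β(x,x) is fixed by σ, so the trace of -zD is -(z + σ(z))D = -D.
    solve x = - (z * D) , (begin
      D + (- (z * D) + S.τ (- (z * D)))        ≡⟨ cong (λ w → D + (- (z * D) + w)) (trans (S.τ-neg (z * D)) (cong -_ (begin
        1# * σ (z * D)                           ≡⟨ trans (*-identityˡ _) (σ-* z D) ⟩
        σ z * σ D                                ≡⟨ cong (σ z *_) (sym (trans (S.β-sym x x) (*-identityˡ _))) ⟩
        σ z * D                                  ∎))) ⟩
      D + (- (z * D) + - (σ z * D))            ≡⟨ cong (D +_) (begin
        - (z * D) + - (σ z * D)                  ≡⟨ cong₂ _+_ (-‿distribʳ-* _ _) (-‿distribʳ-* _ _) ⟩
        z * - D + σ z * - D                      ≡⟨ sym (distribʳ _ _ _) ⟩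
        (z + σ z) * - D                          ≡⟨ cong (_* - D) (proj₂ (trace-unit θ)) ⟩
        1# * - D                                 ≡⟨ *-identityˡ _ ⟩
        - D                                      ∎) ⟩
      D + - D                                  ≡⟨ -‿inverseʳ D ⟩
      0#                                       ∎)
      where D = S.β x x
    pol = S.polarity solve nondegenerate

open import Data.Nat using (_≤_; _^_)

theorem1p1 : (p : ℕ) → Prime p → (k : ℕ) → 1 ≤ k →
    ∃ λ (r₀ : ℕ) → ∀ (r : ℕ) → r₀ ≤ r →
    ∀ (h : ℕ) → 1 ≤ h → (F : FiniteField (p ^ h)) →
    ∀ (n : ℕ) (P : Form F n) → IsPolarForm F P → HasRank F P r →
    ∀ (O : List (Fin k → Vect F n)) → All (IsSpace F P k) O →
    ¬ EveryGeneratorContainsExactlyOne F P O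
theorem1p1 zero          pr = contradiction pr ¬prime[0]
theorem1p1 (suc zero)    pr = contradiction pr ¬prime[1]
theorem1p1 (suc p′@(suc _)) pr (suc k) _ = proj₁ (rank<count p′ (suc k)) ,
  λ { r r₀≤r h@(suc _) _ F n P polar ((e , ind-e , tot-e) , noBig) O spaces exact →
    let pol , describes = Forms.form-polarity F n P polar
        ti-e = PolarTheory.Describes.totIso⇒TI describes tot-e
        f , ef≡δ , ti-f = PolarTheory.hyperbolic F pol ind-e ti-e
        open PolarTheory.Counting F pol describes noBig e f ti-e ti-f ef≡δ using (module Family)
        open Family O spaces exact using (count; bound)
    in ℕ.<⇒≱ (proj₂ (rank<count p′ (suc k)) r r₀≤r h)
         (ℕ.≤-trans count (ℕ.*-monoˡ-≤ (suc p′ ^ h) (bound p′ h pr refl))) }
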